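{- For every constant $c\ge1$ there is a constant $C>0$ (depending only on $c$) such that the following holds. Let $p$ be a prime and let $A,B$ be nonempty subsets of $\mathbb{F}_p$ with $c^{ -1}|A|\le|B|\le c|A|$ and $|A|\le c\,p^{1/2}$. Then \[\max\{|A+B|,|AB|\}\ge C^{ -1}|A|^{15/14}.\]
   Context: $\mathbb{F}_p$ is the field of residue classes modulo the prime $p$. $A+B=\{a+b:a\in A,b\in B\}$, $AB=\{ab:a\in A,b\in B\}$; $|X|$ denotes cardinality. -}

module Defs where

open import Data.Bool using (Bool)
open import Data.Nat as ℕ using (ℕ; zero; suc; NonZero)
open import Data.Nat.DivMod using (_mod_)
open import Data.Fin using (Fin; toℕ)
open import Data.Fin.Properties using (any?; _≟_)
open import Data.Fin.Subset using (Subset; _∈_)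
open import Data.Fin.Subset.Properties using (_∈?_)
open import Data.Vec using (tabulate)
open import Data.Product using (_×_)
open import Data.Integer using (+_)
open import Data.Rational using (ℚ; _/_; 1ℚ; _*_)
open import Relation.Nullary.Decidable using (⌊_⌋; _×-dec_)
open import Relation.Binary.PropositionalEquality using (_≡_)

_+ₚ_ : {p : ℕ} .{{_ : NonZero p}} → Fin p → Fin p → Fin p
_+ₚ_ {p} a b = (toℕ a ℕ.+ toℕ b) mod p

_*ₚ_ : {p : ℕ} .{{_ : NonZero p}} → Fin p → Fin p → Fin p
_*ₚ_ {p} a b = (toℕ a ℕ.* toℕ b) mod p

sumset : {p : ℕ} .{{_ : NonZero p}} → Subset p → Subset p → Subset p
sumset A B = tabulate λ z →
  ⌊ any? (λ a → any? (λ b → (a ∈? A) ×-dec ((b ∈? B) ×-dec ((a +ₚ b) ≟ z)))) ⌋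

prodset : {p : ℕ} .{{_ : NonZero p}} → Subset p → Subset p → Subset p
prodset A B = tabulate λ z →
  ⌊ any? (λ a → any? (λ b → (a ∈? A) ×-dec ((b ∈? B) ×-dec ((a *ₚ b) ≟ z)))) ⌋

ℕ→ℚ : ℕ → ℚ
ℕ→ℚ n = (+ n) / 1

_^ℚ_ : ℚ → ℕ → ℚ
q ^ℚ zero = 1ℚ
q ^ℚ suc n = q * (q ^ℚ n)

{-# OPTIONS --safe #-}
module Submission where

-- Write n = |A|, m = |B| ∼ n, and let M bound |A+B| and |AB|; the exponent comes from the following counts.
-- Petridis' form of Plünnecke's inequality gives A′ ⊆ A with |A′| ≥ n/2 and |A′+B+B| ≪ M²/n, and the
-- multiplicative energy of A′ and B gives b₀ ∈ B with ∑_{b∈B} |Y_b| ≫ n³/M, where Y_b = {a ∈ A′ : ab ∈ b₀A′}.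
-- By a weak-type argument (no dyadic pigeonholing, hence no logarithm) some X = {b : |Y_b| ≥ t} satisfies
-- t²|X| ≫ n⁵/M².  Let R = (X-X)/(X-X).  If R is the whole field, averaging over the slope ξ gives ξ ∈ R for
-- which x + ξy takes ≫ |X|² values on X × X, since |X|² ≪ p; otherwise some ξ ∈ R has ξ + 1 ∉ R.  Writing
-- ξ = (b₁-b₂)/(b₃-b₄), in both cases (b₁-b₂)y + (b₃-b₄)g with g = x or g = x + y is injective on a
-- positive proportion of X × X.  Four pigeonhole steps, each placing one of the terms bᵢy, bᵢg in a translate of
-- -b₀A, then cost the factors M/t, M/t, M²/(nt), M²/(nt) and leave a set that injects into a dilate of
-- A+A-A-A, of size ≪ M⁴/n³.  Hence |X|²t⁴ ≪ M¹⁰/n⁵, and with |X|t² ≫ n⁵/M² this gives n¹⁵ ≪ M¹⁴.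

-- The final count involves the level set only through `|X|²t⁴`, the square of `t²|X|`. So a lower
-- bound for that product alone suffices, and the weak `L²` norm of `b ↦ |Y_b|` can stand in for the
-- `L²` norm; this is what spares the logarithm of a dyadic choice of `t`. A pigeonhole step works
-- because `y ∈ Y_b` gives `b y = b₀ a`: once `z + y` is fixed to `t`, the term `b z` equals
-- `b t - b₀ a`. All `b` share the base `b₀`, so four such terms combine into a single dilate
-- `b₀ (A + A - A - A)`. The obstacle is the slope `ξ + 1`: it forces `g = x + y`, so two of the
-- steps meet a sum of two elements of `B` and one of `A`. Hence the thinning of `A` to `A′`;
-- Petridis' minimiser has a small double sumset but may be tiny, so several of them have to be
-- joined. The sets `A` and `B` play different roles throughout, since only mixed sums and products
-- are controlled: slopes and levels live in `B`, the sets `Y_b` in `A`. Differences are never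
-- formed. Each identity between differences is stated with its negative terms moved across, so that
-- it can be checked in a commutative semiring with cancellation.

open import Defs

-- Finite sets and cardinality by injection

module FiniteSets where

  open import Data.Nat using (ℕ; suc; _+_; _*_; _≤_; _<_; z≤n; s≤s)
  open import Data.Nat.Properties
  open import Data.Nat.Solver using (module +-*-Solver)
  open +-*-Solver using (solve; _:=_; _:+_; _:*_; con)
  open import Data.List using (List; []; _∷_; _++_; length; map; filter; deduplicate; cartesianProduct)
  open import Data.List.Properties using (length-++; length-map)
  open import Data.List.Membership.Propositional using (_∈_; find; lose)
  open import Data.List.Membership.Propositional.Properties
  open import Data.List.Relation.Unary.All as All using (All; []; _∷_)
  import Data.List.Relation.Unary.All.Properties as All
  open import Data.List.Relation.Unary.Any using (Any; here; there)
  open import Data.List.Relation.Unary.AllPairs using ([]; _∷_)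
  open import Data.List.Relation.Unary.Unique.Propositional using (Unique)
  import Data.List.Relation.Unary.Unique.Propositional.Properties as Unique
  import Data.List.Relation.Unary.Unique.DecPropositional.Properties as DecUnique
  open import Data.Product using (Σ; ∃; _×_; _,_; proj₁; proj₂)
  open import Data.Sum using (_⊎_; inj₁; inj₂)
  open import Function using (_∘_)
  open import Level using (0ℓ)
  open import Relation.Nullary using (¬_; Dec; yes; no; contradiction)
  open import Relation.Nullary.Decidable using (¬?)
  open import Relation.Unary using (Pred; Decidable)
  open import Relation.Binary.Definitions using (DecidableEquality)
  open import Relation.Binary.PropositionalEquality

  private variable
    T U V : Set

  -- Distinct entries make `length` the cardinality. Lists with the same members may differ in
  -- order, so sets are compared through `_⊆ˢ_`.
  record FinSet (T : Set) : Set where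
    constructor mkFinSet
    field
      elems  : List T
      unique : Unique elems
  open FinSet public

  infix 4 _∈ˢ_ _⊆ˢ_
  _∈ˢ_ : T → FinSet T → Set
  x ∈ˢ S = x ∈ elems S

  _⊆ˢ_ : FinSet T → FinSet T → Set
  S ⊆ˢ S′ = ∀ {x} → x ∈ˢ S → x ∈ˢ S′

  card : FinSet T → ℕ
  card S = length (elems S)

  infixr 5 _×ˢ_
  _×ˢ_ : FinSet T → FinSet U → FinSet (T × U)
  S ×ˢ S′ = mkFinSet (cartesianProduct (elems S) (elems S′)) (Unique.cartesianProduct⁺ (unique S) (unique S′))

  ∈-×⁺ : (S : FinSet T) (S′ : FinSet U) {x : T} {y : U} → x ∈ˢ S → y ∈ˢ S′ → (x , y) ∈ˢ (S ×ˢ S′)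
  ∈-×⁺ S S′ = ∈-cartesianProduct⁺

  ∈-×⁻ : (S : FinSet T) (S′ : FinSet U) {x : T} {y : U} → (x , y) ∈ˢ (S ×ˢ S′) → x ∈ˢ S × y ∈ˢ S′
  ∈-×⁻ S S′ = ∈-cartesianProduct⁻ (elems S) (elems S′)

  module _ {P : Pred T 0ℓ} (P? : Decidable P) where

    select : FinSet T → FinSet T
    select S = mkFinSet (filter P? (elems S)) (Unique.filter⁺ P? (unique S))

    ∈-select⁺ : (S : FinSet T) {x : T} → x ∈ˢ S → P x → x ∈ˢ select S
    ∈-select⁺ S = ∈-filter⁺ P?

    ∈-select⁻ : (S : FinSet T) {x : T} → x ∈ˢ select S → x ∈ˢ S × P x
    ∈-select⁻ S = ∈-filter⁻ P?

  module _ (_≟_ : DecidableEquality U) (f : T → U) where opaque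

    -- Opaque, so that later arguments rest on the two membership rules and not on how repeated
    -- values are dropped.
    image : FinSet T → FinSet U
    image S = mkFinSet (deduplicate _≟_ (map f (elems S))) (DecUnique.deduplicate-! _≟_ _)

    ∈-image⁺ : (S : FinSet T) {x : T} → x ∈ˢ S → f x ∈ˢ image S
    ∈-image⁺ S x∈S = ∈-deduplicate⁺ _≟_ (∈-map⁺ f x∈S)

    ∈-image⁻ : (S : FinSet T) {y : U} → y ∈ˢ image S → ∃ λ x → x ∈ˢ S × y ≡ f x
    ∈-image⁻ S y∈ = ∈-map⁻ f (∈-deduplicate⁻ _≟_ (map f (elems S)) y∈)

  card-disjoint-union : (S S′ : FinSet T) → (∀ {x} → x ∈ˢ S → ¬ x ∈ˢ S′) →
    Σ (FinSet T) λ W → card W ≡ card S + card S′ × S ⊆ˢ W × S′ ⊆ˢ W × (∀ {x} → x ∈ˢ W → x ∈ˢ S ⊎ x ∈ˢ S′)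
  card-disjoint-union S S′ dis =
      mkFinSet (elems S ++ elems S′) (Unique.++⁺ (unique S) (unique S′) λ (p , q) → dis p q)
    , length-++ (elems S) , ∈-++⁺ˡ , ∈-++⁺ʳ (elems S) , ∈-++⁻ (elems S)

  remove : {x : T} (ys : List T) → x ∈ ys → List T
  remove (_ ∷ ys) (here _)  = ys
  remove (y ∷ ys) (there p) = y ∷ remove ys p

  length-remove : {x : T} (ys : List T) (p : x ∈ ys) → length ys ≡ suc (length (remove ys p))
  length-remove (_ ∷ ys) (here _)  = refl
  length-remove (y ∷ ys) (there p) = cong suc (length-remove ys p)

  ∈-remove : {x z : T} (ys : List T) (p : x ∈ ys) → z ∈ ys → z ≢ x → z ∈ remove ys p
  ∈-remove (_ ∷ ys) (here refl) (here refl) z≢x = contradiction refl z≢x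
  ∈-remove (_ ∷ ys) (here refl) (there q)   z≢x = q
  ∈-remove (y ∷ ys) (there p)   (here refl) z≢x = here refl
  ∈-remove (y ∷ ys) (there p)   (there q)   z≢x = there (∈-remove ys p q z≢x)

  -- Stated for a relation rather than a function, since the partners in S′ are often only known to exist.
  card-≤ : (R : T → U → Set) (S : FinSet T) (S′ : FinSet U) →
    (∀ {x} → x ∈ˢ S → ∃ λ y → y ∈ˢ S′ × R x y) →
    (∀ {x x′ y} → x ∈ˢ S → x′ ∈ˢ S → R x y → R x′ y → x ≡ x′) →
    card S ≤ card S′
  card-≤ {T = T} {U = U} R (mkFinSet xs u) (mkFinSet ys _) = go xs u ys
    where
    go : (xs : List T) → Unique xs → (ys : List U) →
      (∀ {x} → x ∈ xs → ∃ λ y → y ∈ ys × R x y) →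
      (∀ {x x′ y} → x ∈ xs → x′ ∈ xs → R x y → R x′ y → x ≡ x′) →
      length xs ≤ length ys
    go [] _ ys tot inj = z≤n
    go (x ∷ xs) (x∉ ∷ u) ys tot inj with tot (here refl)
    -- The partner `y` of the head is struck from `ys`; by `inj` no later element shares it, so the
    -- partners of the tail survive.
    ... | y , y∈ys , Rxy = subst (suc (length xs) ≤_) (sym (length-remove ys y∈ys))
          (s≤s (go xs u (remove ys y∈ys) tot′ λ p q → inj (there p) (there q)))
      where
      tot′ : ∀ {x′} → x′ ∈ xs → ∃ λ y′ → y′ ∈ remove ys y∈ys × R x′ y′
      tot′ p with tot (there p)
      ... | y′ , y′∈ys , Rx′y′ = y′ , ∈-remove ys y∈ys y′∈ys y′≢y , Rx′y′
        where
        y′≢y : y′ ≢ y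
        y′≢y refl = All.lookup x∉ p (inj (here refl) (there p) Rxy Rx′y′)

  card-≤-fun : (f : T → U) (S : FinSet T) (S′ : FinSet U) →
    (∀ {x} → x ∈ˢ S → f x ∈ˢ S′) →
    (∀ {x x′} → x ∈ˢ S → x′ ∈ˢ S → f x ≡ f x′ → x ≡ x′) →
    card S ≤ card S′
  card-≤-fun f S S′ into inj = card-≤ (λ x y → y ≡ f x) S S′ (λ p → _ , into p , refl)
    λ p q e e′ → inj p q (trans (sym e) e′)

  card-mono : (S S′ : FinSet T) → S ⊆ˢ S′ → card S ≤ card S′
  card-mono S S′ sub = card-≤-fun (λ x → x) S S′ sub λ _ _ e → e

  card-pos⁺ : (S : FinSet T) {x : T} → x ∈ˢ S → 0 < card S
  card-pos⁺ S = ∈-length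

  card-pos⁻ : (S : FinSet T) → 0 < card S → ∃ λ x → x ∈ˢ S
  card-pos⁻ (mkFinSet (x ∷ _) _) _ = x , here refl

  -- Counted in the tagged sum `T ⊎ T`, where the two lists are disjoint. An element of both sets
  -- has two admissible images, which the relational `card-≤` allows.
  card-union-≤ : DecidableEquality T → (S S₁ S₂ : FinSet T) →
    (∀ {x} → x ∈ˢ S → x ∈ˢ S₁ ⊎ x ∈ˢ S₂) → card S ≤ card S₁ + card S₂
  card-union-≤ {T = T} _≟_ S S₁ S₂ cover =
    ≤-trans (card-≤ R S (mkFinSet ws uw) tot inj) (≤-reflexive (trans (length-++ (map inj₁ (elems S₁)))
      (cong₂ _+_ (length-map inj₁ (elems S₁)) (length-map inj₂ (elems S₂)))))
    where
    ws : List (T ⊎ T)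
    ws = map inj₁ (elems S₁) ++ map inj₂ (elems S₂)
    uw : Unique ws
    uw = Unique.++⁺ (Unique.map⁺ (λ {refl → refl}) (unique S₁)) (Unique.map⁺ (λ {refl → refl}) (unique S₂)) dis
      where
      dis : ∀ {v} → ¬ (v ∈ map inj₁ (elems S₁) × v ∈ map inj₂ (elems S₂))
      dis (p , q) with ∈-map⁻ inj₁ p | ∈-map⁻ inj₂ q
      ... | _ , _ , refl | _ , _ , ()
    R : T → T ⊎ T → Set
    R x w = w ≡ inj₁ x ⊎ w ≡ inj₂ x
    tot : ∀ {x} → x ∈ˢ S → ∃ λ y → y ∈ ws × R x y
    tot p with cover p
    ... | inj₁ q = _ , ∈-++⁺ˡ (∈-map⁺ inj₁ q) , inj₁ refl
    ... | inj₂ q = _ , ∈-++⁺ʳ (map inj₁ (elems S₁)) (∈-map⁺ inj₂ q) , inj₂ refl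
    inj : ∀ {x x′ y} → x ∈ˢ S → x′ ∈ˢ S → R x y → R x′ y → x ≡ x′
    inj _ _ (inj₁ refl) (inj₁ refl) = refl
    inj _ _ (inj₁ refl) (inj₂ ())
    inj _ _ (inj₂ refl) (inj₁ ())
    inj _ _ (inj₂ refl) (inj₂ refl) = refl

  -- Indicators, finite sums and averages

  𝟙 : {P : Set} → Dec P → ℕ
  𝟙 (yes _) = 1
  𝟙 (no  _) = 0

  𝟙≤1 : {P : Set} (d : Dec P) → 𝟙 d ≤ 1
  𝟙≤1 (yes _) = ≤-refl
  𝟙≤1 (no  _) = z≤n

  sumList : List T → (T → ℕ) → ℕ
  sumList []       f = 0
  sumList (x ∷ xs) f = f x + sumList xs f

  ∑ : FinSet T → (T → ℕ) → ℕ
  ∑ S = sumList (elems S)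

  private
    sumList-mono : (xs : List T) {f g : T → ℕ} → (∀ {x} → x ∈ xs → f x ≤ g x) → sumList xs f ≤ sumList xs g
    sumList-mono []       le = z≤n
    sumList-mono (x ∷ xs) le = +-mono-≤ (le (here refl)) (sumList-mono xs (le ∘ there))

    sumList-cong : (xs : List T) {f g : T → ℕ} → (∀ x → f x ≡ g x) → sumList xs f ≡ sumList xs g
    sumList-cong []       eq = refl
    sumList-cong (x ∷ xs) eq = cong₂ _+_ (eq x) (sumList-cong xs eq)

    interchange : ∀ a b c d → (a + b) + (c + d) ≡ (a + c) + (b + d)
    interchange = solve 4 (λ a b c d → (a :+ b) :+ (c :+ d) := (a :+ c) :+ (b :+ d)) refl

    sumList-+ : (xs : List T) (f g : T → ℕ) → sumList xs (λ x → f x + g x) ≡ sumList xs f + sumList xs g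
    sumList-+ []       f g = refl
    sumList-+ (x ∷ xs) f g = trans (cong (f x + g x +_) (sumList-+ xs f g)) (interchange (f x) (g x) _ _)

    sumList-const : (xs : List T) (k : ℕ) → sumList xs (λ _ → k) ≡ length xs * k
    sumList-const []       k = refl
    sumList-const (x ∷ xs) k = cong (k +_) (sumList-const xs k)

    sumList-*ˡ : (xs : List T) (k : ℕ) (f : T → ℕ) → sumList xs (λ x → k * f x) ≡ k * sumList xs f
    sumList-*ˡ []       k f = sym (*-zeroʳ k)
    sumList-*ˡ (x ∷ xs) k f = trans (cong (k * f x +_) (sumList-*ˡ xs k f)) (sym (*-distribˡ-+ k (f x) _))

    sumList-swap : (xs : List T) (ys : List U) (f : T → U → ℕ) →
      sumList xs (λ x → sumList ys (f x)) ≡ sumList ys (λ y → sumList xs (λ x → f x y))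
    sumList-swap []       ys f = sym (trans (sumList-const ys 0) (*-zeroʳ (length ys)))
    sumList-swap (x ∷ xs) ys f = trans (cong (sumList ys (f x) +_) (sumList-swap xs ys f))
      (sym (sumList-+ ys (f x) _))

    sumList-𝟙 : {P : Pred T 0ℓ} (P? : Decidable P) (xs : List T) → sumList xs (λ x → 𝟙 (P? x)) ≡ length (filter P? xs)
    sumList-𝟙 P? [] = refl
    sumList-𝟙 P? (x ∷ xs) with P? x
    ... | yes p = cong suc (sumList-𝟙 P? xs)
    ... | no ¬p = sumList-𝟙 P? xs

    sumList-++ : (xs ys : List T) (f : T → ℕ) → sumList (xs ++ ys) f ≡ sumList xs f + sumList ys f
    sumList-++ []       ys f = refl
    sumList-++ (x ∷ xs) ys f = trans (cong (f x +_) (sumList-++ xs ys f)) (sym (+-assoc (f x) _ _))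

    sumList-map : (xs : List T) (g : T → U) (f : U → ℕ) → sumList (map g xs) f ≡ sumList xs (f ∘ g)
    sumList-map []       g f = refl
    sumList-map (x ∷ xs) g f = cong (f (g x) +_) (sumList-map xs g f)

    sumList-× : (xs : List T) (ys : List U) (f : T × U → ℕ) →
      sumList (cartesianProduct xs ys) f ≡ sumList xs (λ x → sumList ys (λ y → f (x , y)))
    sumList-× []       ys f = refl
    sumList-× (x ∷ xs) ys f = trans (sumList-++ (map (x ,_) ys) _ f)
      (cong₂ _+_ (sumList-map ys (x ,_) f) (sumList-× xs ys f))

    sumList-max : T → (xs : List T) (f : T → ℕ) → ∃ λ t → sumList xs f ≤ length xs * f t
    sumList-max t₀ []       f = t₀ , z≤n
    sumList-max t₀ (x ∷ xs) f with sumList-max t₀ xs f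
    ... | t , le with ≤-total (f x) (f t)
    ...   | inj₁ fx≤ft = t , +-mono-≤ fx≤ft le
    ...   | inj₂ ft≤fx = x , +-monoʳ-≤ (f x) (≤-trans le (*-monoʳ-≤ (length xs) ft≤fx))

    sumList-max-∈ : {x : T} (xs : List T) (f : T → ℕ) → x ∈ xs →
      ∃ λ t → t ∈ xs × sumList xs f ≤ length xs * f t
    sumList-max-∈ (x ∷ []) f _ = x , here refl , ≤-refl
    sumList-max-∈ (x ∷ xs@(_ ∷ _)) f _ with sumList-max-∈ xs f (here refl)
    ... | t , t∈ , le with ≤-total (f x) (f t)
    ...   | inj₁ fx≤ft = t , there t∈ , +-mono-≤ fx≤ft le
    ...   | inj₂ ft≤fx = x , here refl , +-monoʳ-≤ (f x) (≤-trans le (*-monoʳ-≤ (length xs) ft≤fx))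

    sumList-min-∈ : {x : T} (xs : List T) (f : T → ℕ) → x ∈ xs →
      ∃ λ t → t ∈ xs × length xs * f t ≤ sumList xs f
    sumList-min-∈ (x ∷ []) f _ = x , here refl , ≤-refl
    sumList-min-∈ (x ∷ xs@(_ ∷ _)) f _ with sumList-min-∈ xs f (here refl)
    ... | t , t∈ , le with ≤-total (f x) (f t)
    ...   | inj₂ ft≤fx = t , there t∈ , +-mono-≤ ft≤fx le
    ...   | inj₁ fx≤ft = x , here refl , +-monoʳ-≤ (f x) (≤-trans (*-monoʳ-≤ (length xs) fx≤ft) le)

  ∑-mono : (S : FinSet T) {f g : T → ℕ} → (∀ {x} → x ∈ˢ S → f x ≤ g x) → ∑ S f ≤ ∑ S g
  ∑-mono S = sumList-mono (elems S)

  ∑-cong : (S : FinSet T) {f g : T → ℕ} → (∀ x → f x ≡ g x) → ∑ S f ≡ ∑ S g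
  ∑-cong S = sumList-cong (elems S)

  ∑-+ : (S : FinSet T) (f g : T → ℕ) → ∑ S (λ x → f x + g x) ≡ ∑ S f + ∑ S g
  ∑-+ S = sumList-+ (elems S)

  ∑-const : (S : FinSet T) (k : ℕ) → ∑ S (λ _ → k) ≡ card S * k
  ∑-const S = sumList-const (elems S)

  ∑-*ˡ : (S : FinSet T) (k : ℕ) (f : T → ℕ) → ∑ S (λ x → k * f x) ≡ k * ∑ S f
  ∑-*ˡ S = sumList-*ˡ (elems S)

  ∑-swap : (S : FinSet T) (S′ : FinSet U) (f : T → U → ℕ) →
    ∑ S (λ x → ∑ S′ (f x)) ≡ ∑ S′ (λ y → ∑ S (λ x → f x y))
  ∑-swap S S′ = sumList-swap (elems S) (elems S′)

  ∑-𝟙 : {P : Pred T 0ℓ} (P? : Decidable P) (S : FinSet T) → ∑ S (λ x → 𝟙 (P? x)) ≡ card (select P? S)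
  ∑-𝟙 P? S = sumList-𝟙 P? (elems S)

  ∑-× : (S : FinSet T) (S′ : FinSet U) (f : T × U → ℕ) →
    ∑ (S ×ˢ S′) f ≡ ∑ S (λ x → ∑ S′ (λ y → f (x , y)))
  ∑-× S S′ = sumList-× (elems S) (elems S′)

  card-× : (S : FinSet T) (S′ : FinSet U) → card (S ×ˢ S′) ≡ card S * card S′
  card-× S S′ = begin
    card (S ×ˢ S′)              ≡⟨ *-identityʳ _ ⟨
    card (S ×ˢ S′) * 1          ≡⟨ ∑-const (S ×ˢ S′) 1 ⟨
    ∑ (S ×ˢ S′) (λ _ → 1)       ≡⟨ ∑-× S S′ (λ _ → 1) ⟩
    ∑ S (λ _ → ∑ S′ λ _ → 1)    ≡⟨ ∑-const S _ ⟩
    card S * ∑ S′ (λ _ → 1)     ≡⟨ cong (card S *_) (trans (∑-const S′ 1) (*-identityʳ _)) ⟩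
    card S * card S′            ∎
    where open ≡-Reasoning

  -- The maximisation starts from `t₀`, which covers an empty `S`; the price is that the maximiser
  -- may lie outside `S`.
  average-≤ : T → (S : FinSet T) (f : T → ℕ) → ∃ λ t → ∑ S f ≤ card S * f t
  average-≤ t₀ S = sumList-max t₀ (elems S)

  average-≤-∈ : (S : FinSet T) (f : T → ℕ) {x : T} → x ∈ˢ S → ∃ λ t → t ∈ˢ S × ∑ S f ≤ card S * f t
  average-≤-∈ S f = sumList-max-∈ (elems S) f

  average-≥-∈ : (S : FinSet T) (f : T → ℕ) {x : T} → x ∈ˢ S → ∃ λ t → t ∈ˢ S × card S * f t ≤ ∑ S f
  average-≥-∈ S f = sumList-min-∈ (elems S) f

  card-select-split : {P : Pred T 0ℓ} (P? : Decidable P) (S : FinSet T) →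
    card S ≡ card (select P? S) + card (select (¬? ∘ P?) S)
  card-select-split {T = T} {P} P? S = go (elems S)
    where
    go : (xs : List T) → length xs ≡ length (filter P? xs) + length (filter (¬? ∘ P?) xs)
    go [] = refl
    go (x ∷ xs) with P? x
    ... | yes p = cong suc (go xs)
    ... | no ¬p = trans (cong suc (go xs)) (sym (+-suc _ _))

  -- Collapses one variable of a count: a partner that is unique whenever it exists contributes no
  -- more than the indicator of its existence.
  ∑-𝟙-≤ : {P : Pred T 0ℓ} (P? : Decidable P) (S : FinSet T) →
    (∀ {x y} → x ∈ˢ S → y ∈ˢ S → P x → P y → x ≡ y) →
    (d : Dec (Any P (elems S))) → ∑ S (λ x → 𝟙 (P? x)) ≤ 𝟙 d
  ∑-𝟙-≤ {P = P} P? S once (yes some) with find some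
  ... | x , x∈ , Px = ≤-trans (≤-reflexive (∑-𝟙 P? S))
        (card-mono (select P? S) (mkFinSet (x ∷ []) ([] ∷ [])) λ p →
          here (once (proj₁ (∈-select⁻ P? S p)) x∈ (proj₂ (∈-select⁻ P? S p)) Px))
  ∑-𝟙-≤ P? S once (no none) = ≤-trans (≤-reflexive (∑-𝟙 P? S))
    (card-mono (select P? S) (mkFinSet [] []) λ p →
      contradiction (lose (proj₁ (∈-select⁻ P? S p)) (proj₂ (∈-select⁻ P? S p))) none)

  -- Cauchy-Schwarz and energy

  2xy≤x²+y² : ∀ x y → 2 * (x * y) ≤ x * x + y * y
  2xy≤x²+y² x y with ≤-total x y
  ... | inj₁ x≤y with m≤n⇒∃[o]m+o≡n x≤y
  ...   | d , refl = ≤-trans (m≤m+n _ (d * d)) (≤-reflexive (lemma x d))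
    where
    lemma : ∀ x d → 2 * (x * (x + d)) + d * d ≡ x * x + (x + d) * (x + d)
    lemma = solve 2 (λ x d → con 2 :* (x :* (x :+ d)) :+ d :* d := x :* x :+ (x :+ d) :* (x :+ d)) refl
  2xy≤x²+y² x y | inj₂ y≤x with m≤n⇒∃[o]m+o≡n y≤x
  ...   | d , refl = ≤-trans (m≤m+n _ (d * d)) (≤-reflexive (lemma y d))
    where
    lemma : ∀ y d → 2 * ((y + d) * y) + d * d ≡ (y + d) * (y + d) + y * y
    lemma = solve 2 (λ y d → con 2 :* ((y :+ d) :* y) :+ d :* d := (y :+ d) :* (y :+ d) :+ y :* y) refl

  -- Induction on the list: the cross terms `2 a r(x)` that a new value `a` creates are absorbed one
  -- by one through `2 a r ≤ a² + r²`.
  cauchy-schwarz : (S : FinSet T) (r : T → ℕ) → ∑ S r * ∑ S r ≤ card S * ∑ S (λ x → r x * r x)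
  cauchy-schwarz {T = T} S r = go (elems S)
    where
    open ≤-Reasoning
    cross : (a : ℕ) (xs : List T) → 2 * (a * sumList xs r) ≤ length xs * (a * a) + sumList xs (λ x → r x * r x)
    cross a [] = ≤-reflexive (trans (cong (2 *_) (*-zeroʳ a)) refl)
    cross a (x ∷ xs) = begin
      2 * (a * (r x + R))                      ≡⟨ solve 3 (λ a b R → con 2 :* (a :* (b :+ R)) := con 2 :* (a :* b) :+ con 2 :* (a :* R)) refl a (r x) R ⟩
      2 * (a * r x) + 2 * (a * R)              ≤⟨ +-mono-≤ (2xy≤x²+y² a (r x)) (cross a xs) ⟩
      a * a + r x * r x + (L * (a * a) + Q)    ≡⟨ interchange (a * a) (r x * r x) (L * (a * a)) Q ⟩
      (a * a + L * (a * a)) + (r x * r x + Q)  ∎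
      where
      R = sumList xs r
      L = length xs
      Q = sumList xs (λ x → r x * r x)
    go : (xs : List T) → sumList xs r * sumList xs r ≤ length xs * sumList xs (λ x → r x * r x)
    go [] = z≤n
    go (x ∷ xs) = begin
      (a + R) * (a + R)                        ≡⟨ solve 2 (λ a R → (a :+ R) :* (a :+ R) := a :* a :+ con 2 :* (a :* R) :+ R :* R) refl a R ⟩
      a * a + 2 * (a * R) + R * R              ≤⟨ +-mono-≤ (+-monoʳ-≤ (a * a) (cross a xs)) (go xs) ⟩
      a * a + (L * (a * a) + Q) + L * Q        ≡⟨ solve 3 (λ a L Q → a :* a :+ (L :* (a :* a) :+ Q) :+ L :* Q := (con 1 :+ L) :* (a :* a :+ Q)) refl a L Q ⟩
      suc L * (a * a + Q)                      ∎
      where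
      a = r x
      R = sumList xs r
      L = length xs
      Q = sumList xs (λ x → r x * r x)

  -- For multiplication on `A ×ˢ B` this is the multiplicative energy; for `(x , y) ↦ x + ξ y` on
  -- `X ×ˢ X` it is the additive energy of `X` and `ξ X`.
  energy : DecidableEquality U → (T → U) → FinSet T → ℕ
  energy _≟_ f S = ∑ S λ s → ∑ S λ s′ → 𝟙 (f s ≟ f s′)

  -- Cauchy-Schwarz for the fibre sizes `r v`: they account for all of `S`, and their squares count
  -- pairs in a common fibre, which are pairs with equal values.
  card²≤card*energy : (_≟_ : DecidableEquality U) (f : T → U) (S : FinSet T) (V : FinSet U) →
    (∀ {s} → s ∈ˢ S → f s ∈ˢ V) → card S * card S ≤ card V * energy _≟_ f S
  card²≤card*energy {U = U} {T = T} _≟_ f S V into = begin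
    card S * card S                       ≤⟨ *-mono-≤ total total ⟩
    ∑ V r * ∑ V r                         ≤⟨ cauchy-schwarz V r ⟩
    card V * ∑ V (λ v → r v * r v)        ≤⟨ *-monoʳ-≤ (card V) squares ⟩
    card V * energy _≟_ f S               ∎
    where
    open ≤-Reasoning
    r : U → ℕ
    r v = ∑ S λ s → 𝟙 (f s ≟ v)
    total : card S ≤ ∑ V r
    total = begin
      card S                                ≡⟨ *-identityʳ (card S) ⟨
      card S * 1                            ≡⟨ ∑-const S 1 ⟨
      ∑ S (λ _ → 1)                         ≤⟨ ∑-mono S one ⟩
      ∑ S (λ s → ∑ V λ v → 𝟙 (f s ≟ v))     ≡⟨ ∑-swap S V (λ s v → 𝟙 (f s ≟ v)) ⟩
      ∑ V r                                 ∎
      where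
      one : ∀ {s} → s ∈ˢ S → 1 ≤ ∑ V λ v → 𝟙 (f s ≟ v)
      one {s} p = ≤-trans (card-pos⁺ (select (λ v → f s ≟ v) V) (∈-select⁺ (λ v → f s ≟ v) V (into p) refl))
        (≤-reflexive (sym (∑-𝟙 (λ v → f s ≟ v) V)))
    pair : ∀ s s′ → ∑ V (λ v → 𝟙 (f s ≟ v) * 𝟙 (f s′ ≟ v)) ≤ 𝟙 (f s ≟ f s′)
    pair s s′ with f s ≟ f s′
    ... | yes _ = begin
      ∑ V (λ v → 𝟙 (f s ≟ v) * 𝟙 (f s′ ≟ v))  ≤⟨ ∑-mono V (λ {v} _ → drop (f s ≟ v) (f s′ ≟ v)) ⟩
      ∑ V (λ v → 𝟙 (f s ≟ v))                 ≡⟨ ∑-𝟙 (λ v → f s ≟ v) V ⟩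
      card (select (λ v → f s ≟ v) V)         ≤⟨ card-mono (select (λ v → f s ≟ v) V) (mkFinSet (f s ∷ []) ([] ∷ []))
                                                   (λ p → here (sym (proj₂ (∈-select⁻ (λ v → f s ≟ v) V p)))) ⟩
      1                                       ∎
      where
      drop : {P Q : Set} (d : Dec P) (e : Dec Q) → 𝟙 d * 𝟙 e ≤ 𝟙 d
      drop (yes _) (yes _) = s≤s z≤n
      drop (yes _) (no _)  = z≤n
      drop (no _)  _       = z≤n
    ... | no fs≢fs′ = begin
      ∑ V (λ v → 𝟙 (f s ≟ v) * 𝟙 (f s′ ≟ v))  ≡⟨ ∑-cong V (λ v → none (f s ≟ v) (f s′ ≟ v)) ⟩
      ∑ V (λ _ → 0)                           ≡⟨ trans (∑-const V 0) (*-zeroʳ (card V)) ⟩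
      0                                       ∎
      where
      none : ∀ {v} (d : Dec (f s ≡ v)) (e : Dec (f s′ ≡ v)) → 𝟙 d * 𝟙 e ≡ 0
      none (yes p) (yes q) = contradiction (trans p (sym q)) fs≢fs′
      none (yes _) (no _)  = refl
      none (no _)  _       = refl
    expand : ∀ v → r v * r v ≡ ∑ S λ s → ∑ S λ s′ → 𝟙 (f s ≟ v) * 𝟙 (f s′ ≟ v)
    expand v = trans (*-comm (r v) (r v)) (trans (sym (∑-*ˡ S (r v) λ s → 𝟙 (f s ≟ v)))
      (∑-cong S λ s → trans (*-comm (r v) _) (sym (∑-*ˡ S (𝟙 (f s ≟ v)) (λ s′ → 𝟙 (f s′ ≟ v))))))
    squares : ∑ V (λ v → r v * r v) ≤ energy _≟_ f S
    squares = begin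
      ∑ V (λ v → r v * r v)
        ≡⟨ ∑-cong V expand ⟩
      ∑ V (λ v → ∑ S λ s → ∑ S λ s′ → 𝟙 (f s ≟ v) * 𝟙 (f s′ ≟ v))
        ≡⟨ ∑-swap V S _ ⟩
      ∑ S (λ s → ∑ V λ v → ∑ S λ s′ → 𝟙 (f s ≟ v) * 𝟙 (f s′ ≟ v))
        ≡⟨ ∑-cong S (λ s → ∑-swap V S _) ⟩
      ∑ S (λ s → ∑ S λ s′ → ∑ V λ v → 𝟙 (f s ≟ v) * 𝟙 (f s′ ≟ v))
        ≤⟨ ∑-mono S (λ {s} _ → ∑-mono S λ {s′} _ → pair s s′) ⟩
      energy _≟_ f S ∎

open FiniteSets

-- The algebraic setting

module Domains where

  open import Algebra.Structures using (IsCommutativeSemiring)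
  open import Relation.Binary.Definitions using (DecidableEquality)
  open import Relation.Binary.PropositionalEquality using (_≡_; _≢_)

  -- A finite integral domain, additively generated by 1#, axiomatised without negation:
  -- cross-cancel says that (x - y) (z - w) = 0 forces z = w when x ≠ y.
  record FiniteDomain : Set₁ where
    field
      F            : Set
      _≟_          : DecidableEquality F
      _⊹_ _·_      : F → F → F
      0# 1#        : F
      isCommutativeSemiring : IsCommutativeSemiring _≡_ _⊹_ _·_ 0# 1#
      ⊹-cancelʳ    : ∀ z {x y} → x ⊹ z ≡ y ⊹ z → x ≡ y
      cross-cancel : ∀ {x y z w} → x ≢ y → x · z ⊹ y · w ≡ x · w ⊹ y · z → z ≡ w
      univ         : FinSet F
      complete     : ∀ x → x ∈ˢ univ
      1#-generates : (P : F → Set) → P 0# → (∀ x → P x → P (x ⊹ 1#)) → ∀ x → P x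
    infixl 6 _⊹_
    infixl 7 _·_
    infix 4 _≟_

open Domains using (FiniteDomain)

-- Identities between differences, without subtraction

module Identities (D : FiniteDomain) where

  open FiniteDomain D
  open import Algebra.Bundles using (CommutativeSemiring)
  open import Level using (0ℓ)
  open import Relation.Binary.PropositionalEquality

  commutativeSemiring : CommutativeSemiring 0ℓ 0ℓ
  commutativeSemiring = record { isCommutativeSemiring = isCommutativeSemiring }

  open import Algebra.Solver.Ring.NaturalCoefficients.Default commutativeSemiring
    using (solve; _:=_; _:+_; _:*_; con)

  -- If ξ = (b₁ - b₂) / (b₃ - b₄), then (b₁ - b₂) y + (b₃ - b₄) g determines g + ξ y.
  ratio-transfer : ∀ {ξ b₁ b₂ b₃ b₄} y g y′ g′ → b₃ ≢ b₄ → b₁ ⊹ ξ · b₄ ≡ b₂ ⊹ ξ · b₃ →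
    (b₁ · y ⊹ b₃ · g) ⊹ (b₂ · y′ ⊹ b₄ · g′) ≡ (b₁ · y′ ⊹ b₃ · g′) ⊹ (b₂ · y ⊹ b₄ · g) →
    g ⊹ ξ · y ≡ g′ ⊹ ξ · y′
  ratio-transfer {ξ} {b₁} {b₂} {b₃} {b₄} y g y′ g′ b₃≢b₄ ratio eq =
    cross-cancel b₃≢b₄ (⊹-cancelʳ (b₂ · y ⊹ b₁ · y′) (begin
      b₃ · (g ⊹ ξ · y) ⊹ b₄ · (g′ ⊹ ξ · y′) ⊹ (b₂ · y ⊹ b₁ · y′)
        ≡⟨ solve 9 (λ ξ b₁ b₂ b₃ b₄ y g y′ g′ →
             b₃ :* (g :+ ξ :* y) :+ b₄ :* (g′ :+ ξ :* y′) :+ (b₂ :* y :+ b₁ :* y′)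
             := (b₂ :+ ξ :* b₃) :* y :+ (b₁ :+ ξ :* b₄) :* y′ :+ (b₃ :* g :+ b₄ :* g′)) refl ξ b₁ b₂ b₃ b₄ y g y′ g′ ⟩
      (b₂ ⊹ ξ · b₃) · y ⊹ (b₁ ⊹ ξ · b₄) · y′ ⊹ (b₃ · g ⊹ b₄ · g′)
        ≡⟨ cong₂ (λ u v → u · y ⊹ v · y′ ⊹ (b₃ · g ⊹ b₄ · g′)) (sym ratio) ratio ⟩
      (b₁ ⊹ ξ · b₄) · y ⊹ (b₂ ⊹ ξ · b₃) · y′ ⊹ (b₃ · g ⊹ b₄ · g′)
        ≡⟨ solve 9 (λ ξ b₁ b₂ b₃ b₄ y g y′ g′ →
             (b₁ :+ ξ :* b₄) :* y :+ (b₂ :+ ξ :* b₃) :* y′ :+ (b₃ :* g :+ b₄ :* g′)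
             := ((b₁ :* y :+ b₃ :* g) :+ (b₂ :* y′ :+ b₄ :* g′)) :+ (ξ :* b₄ :* y :+ ξ :* b₃ :* y′)) refl ξ b₁ b₂ b₃ b₄ y g y′ g′ ⟩
      ((b₁ · y ⊹ b₃ · g) ⊹ (b₂ · y′ ⊹ b₄ · g′)) ⊹ (ξ · b₄ · y ⊹ ξ · b₃ · y′)
        ≡⟨ cong (_⊹ (ξ · b₄ · y ⊹ ξ · b₃ · y′)) eq ⟩
      ((b₁ · y′ ⊹ b₃ · g′) ⊹ (b₂ · y ⊹ b₄ · g)) ⊹ (ξ · b₄ · y ⊹ ξ · b₃ · y′)
        ≡⟨ solve 9 (λ ξ b₁ b₂ b₃ b₄ y g y′ g′ →
             ((b₁ :* y′ :+ b₃ :* g′) :+ (b₂ :* y :+ b₄ :* g)) :+ (ξ :* b₄ :* y :+ ξ :* b₃ :* y′)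
             := b₃ :* (g′ :+ ξ :* y′) :+ b₄ :* (g :+ ξ :* y) :+ (b₂ :* y :+ b₁ :* y′)) refl ξ b₁ b₂ b₃ b₄ y g y′ g′ ⟩
      b₃ · (g′ ⊹ ξ · y′) ⊹ b₄ · (g ⊹ ξ · y) ⊹ (b₂ · y ⊹ b₁ · y′) ∎))
    where open ≡-Reasoning

  -- Both slopes equal `(x′ - x) / (y - y′)`. This limits two pairs with `y ≠ y′` to one slope at
  -- which they collide.
  ratio-unique : ∀ {ξ ξ′} x y x′ y′ → y ≢ y′ → x ⊹ ξ · y ≡ x′ ⊹ ξ · y′ → x ⊹ ξ′ · y ≡ x′ ⊹ ξ′ · y′ → ξ ≡ ξ′
  ratio-unique {ξ} {ξ′} x y x′ y′ y≢y′ e e′ = cross-cancel y≢y′ (⊹-cancelʳ (x ⊹ x′) (begin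
      y · ξ ⊹ y′ · ξ′ ⊹ (x ⊹ x′)
        ≡⟨ solve 6 (λ ξ ξ′ x y x′ y′ → y :* ξ :+ y′ :* ξ′ :+ (x :+ x′) := (x :+ ξ :* y) :+ (x′ :+ ξ′ :* y′)) refl ξ ξ′ x y x′ y′ ⟩
      (x ⊹ ξ · y) ⊹ (x′ ⊹ ξ′ · y′)
        ≡⟨ cong₂ _⊹_ e (sym e′) ⟩
      (x′ ⊹ ξ · y′) ⊹ (x ⊹ ξ′ · y)
        ≡⟨ solve 6 (λ ξ ξ′ x y x′ y′ → (x′ :+ ξ :* y′) :+ (x :+ ξ′ :* y) := y :* ξ′ :+ y′ :* ξ :+ (x :+ x′)) refl ξ ξ′ x y x′ y′ ⟩
      y · ξ′ ⊹ y′ · ξ ⊹ (x ⊹ x′) ∎))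
    where open ≡-Reasoning

  -- Taking `g = x + y` at slope `ξ` amounts to taking `g = x` at slope `ξ + 1`; this is how a slope
  -- outside the ratio set is reached with coefficients from inside it.
  shift-ratio : ∀ ξ x y → (x ⊹ y) ⊹ ξ · y ≡ x ⊹ (ξ ⊹ 1#) · y
  shift-ratio = solve 3 (λ ξ x y → (x :+ y) :+ ξ :* y := x :+ (ξ :+ con 1) :* y) refl

  -- Fixing `z + y = t` turns `b z` into `b t - b₀ a`, because `b y = b₀ a`.
  hit : ∀ {b b₀ z y a t} → z ⊹ y ≡ t → y · b ≡ a · b₀ → b · z ⊹ b₀ · a ≡ b · t
  hit {b} {b₀} {z} {y} {a} refl e = begin
    b · z ⊹ b₀ · a   ≡⟨ solve 4 (λ b b₀ z a → b :* z :+ b₀ :* a := b :* z :+ a :* b₀) refl b b₀ z a ⟩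
    b · z ⊹ a · b₀   ≡⟨ cong (b · z ⊹_) (sym e) ⟩
    b · z ⊹ y · b    ≡⟨ solve 3 (λ b z y → b :* z :+ y :* b := b :* (z :+ y)) refl b z y ⟩
    b · (z ⊹ y)      ∎
    where open ≡-Reasoning

  -- The auxiliary `x` cancels from the difference of `x + a₁ + a₃` and `x + a₂ + a₄`, leaving
  -- `a₁ + a₃ - a₂ - a₄`.
  eliminate-translate : ∀ {x x′ a₁ a₂ a₃ a₄ a₁′ a₂′ a₃′ a₄′} →
    (x ⊹ a₂) ⊹ a₄ ≡ (x′ ⊹ a₂′) ⊹ a₄′ → (x ⊹ a₁) ⊹ a₃ ≡ (x′ ⊹ a₁′) ⊹ a₃′ →
    (a₁ ⊹ a₃) ⊹ (a₂′ ⊹ a₄′) ≡ (a₁′ ⊹ a₃′) ⊹ (a₂ ⊹ a₄)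
  eliminate-translate {x} {x′} {a₁} {a₂} {a₃} {a₄} {a₁′} {a₂′} {a₃′} {a₄′} u v = ⊹-cancelʳ (x ⊹ x′) (begin
    (a₁ ⊹ a₃) ⊹ (a₂′ ⊹ a₄′) ⊹ (x ⊹ x′)
      ≡⟨ solve 6 (λ p q p′ q′ x x′ → (p :+ q) :+ (p′ :+ q′) :+ (x :+ x′) := ((x :+ p) :+ q) :+ ((x′ :+ p′) :+ q′)) refl a₁ a₃ a₂′ a₄′ x x′ ⟩
    ((x ⊹ a₁) ⊹ a₃) ⊹ ((x′ ⊹ a₂′) ⊹ a₄′)
      ≡⟨ cong₂ _⊹_ v (sym u) ⟩
    ((x′ ⊹ a₁′) ⊹ a₃′) ⊹ ((x ⊹ a₂) ⊹ a₄)
      ≡⟨ solve 6 (λ p q p′ q′ x x′ → ((x′ :+ p′) :+ q′) :+ ((x :+ p) :+ q) := (p′ :+ q′) :+ (p :+ q) :+ (x :+ x′)) refl a₂ a₄ a₁′ a₃′ x x′ ⟩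
    (a₁′ ⊹ a₃′) ⊹ (a₂ ⊹ a₄) ⊹ (x ⊹ x′) ∎)
    where open ≡-Reasoning

  -- Each hypothesis says that `b₀ aᵢ` plus one of `α`, `β`, `γ`, `δ` is unchanged by priming. So
  -- `b₀ (a₁ + a₃ - a₂ - a₄)` determines `α + β - γ - δ`, in use `(b₁ - b₂) y + (b₃ - b₄) g`.
  combine-hits : ∀ {b₀ α β γ δ α′ β′ γ′ δ′ a₁ a₂ a₃ a₄ a₁′ a₂′ a₃′ a₄′} →
    α ⊹ b₀ · a₁ ≡ α′ ⊹ b₀ · a₁′ → γ ⊹ b₀ · a₂ ≡ γ′ ⊹ b₀ · a₂′ →
    β ⊹ b₀ · a₃ ≡ β′ ⊹ b₀ · a₃′ → δ ⊹ b₀ · a₄ ≡ δ′ ⊹ b₀ · a₄′ →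
    (a₁ ⊹ a₃) ⊹ (a₂′ ⊹ a₄′) ≡ (a₁′ ⊹ a₃′) ⊹ (a₂ ⊹ a₄) →
    (α ⊹ β) ⊹ (γ′ ⊹ δ′) ≡ (α′ ⊹ β′) ⊹ (γ ⊹ δ)
  combine-hits {b₀} {α} {β} {γ} {δ} {α′} {β′} {γ′} {δ′} {a₁} {a₂} {a₃} {a₄} {a₁′} {a₂′} {a₃′} {a₄′} e₁ e₂ e₃ e₄ e =
    ⊹-cancelʳ (b₀ · ((a₁ ⊹ a₃) ⊹ (a₂′ ⊹ a₄′))) (begin
      (α ⊹ β) ⊹ (γ′ ⊹ δ′) ⊹ b₀ · ((a₁ ⊹ a₃) ⊹ (a₂′ ⊹ a₄′))
        ≡⟨ solve 9 (λ b α β γ δ p q r s → (α :+ β) :+ (γ :+ δ) :+ b :* ((p :+ q) :+ (r :+ s))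
             := ((α :+ b :* p) :+ (β :+ b :* q)) :+ ((γ :+ b :* r) :+ (δ :+ b :* s))) refl b₀ α β γ′ δ′ a₁ a₃ a₂′ a₄′ ⟩
      ((α ⊹ b₀ · a₁) ⊹ (β ⊹ b₀ · a₃)) ⊹ ((γ′ ⊹ b₀ · a₂′) ⊹ (δ′ ⊹ b₀ · a₄′))
        ≡⟨ cong₂ _⊹_ (cong₂ _⊹_ e₁ e₃) (cong₂ _⊹_ (sym e₂) (sym e₄)) ⟩
      ((α′ ⊹ b₀ · a₁′) ⊹ (β′ ⊹ b₀ · a₃′)) ⊹ ((γ ⊹ b₀ · a₂) ⊹ (δ ⊹ b₀ · a₄))
        ≡⟨ solve 9 (λ b α β γ δ p q r s → (α :+ β) :+ (γ :+ δ) :+ b :* ((p :+ q) :+ (r :+ s))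
             := ((α :+ b :* p) :+ (β :+ b :* q)) :+ ((γ :+ b :* r) :+ (δ :+ b :* s))) refl b₀ α′ β′ γ δ a₁′ a₃′ a₂ a₄ ⟨
      (α′ ⊹ β′) ⊹ (γ ⊹ δ) ⊹ b₀ · ((a₁′ ⊹ a₃′) ⊹ (a₂ ⊹ a₄))
        ≡⟨ cong (λ w → (α′ ⊹ β′) ⊹ (γ ⊹ δ) ⊹ b₀ · w) (sym e) ⟩
      (α′ ⊹ β′) ⊹ (γ ⊹ δ) ⊹ b₀ · ((a₁ ⊹ a₃) ⊹ (a₂′ ⊹ a₄′)) ∎)
    where open ≡-Reasoning

-- Bookkeeping of exponents and constants

module Arithmetic where

  open import Data.Nat using (ℕ; _*_; _^_; _≤_; _<_; >-nonZero)
  open import Data.Nat.Properties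
  open import Data.Nat.Solver using (module +-*-Solver)
  open +-*-Solver using (solve; _:=_; _:*_; con)
  open import Relation.Binary.PropositionalEquality
  open ≤-Reasoning

  infix 8 _²
  _² : ℕ → ℕ
  x ² = x * x

  ²-mono-≤ : ∀ {x y} → x ≤ y → x ² ≤ y ²
  ²-mono-≤ x≤y = *-mono-≤ x≤y x≤y

  ²-* : ∀ x y → (x * y) ² ≡ x ² * y ²
  ²-* = solve 2 (λ x y → (x :* y) :* (x :* y) := (x :* x) :* (y :* y)) refl

  -- Here `n = |A′|`, `m = |B|`, `q` bounds the products, `G = ∑ |Y_b|` and `x = |X|`. Squaring the
  -- energy bound and inserting the heavy level yields the lower bound for `t²|X|`.
  energy-level : ∀ k n m q G t x → 0 < m → n ² * m ≤ q * G → G ² ≤ k * m * (t ² * x) →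
    n ² ² * m ≤ k * q ² * (t ² * x)
  energy-level k n m q G t x 0<m n²m≤qG G²≤ = *-cancelʳ-≤ _ _ m {{>-nonZero 0<m}} (begin
    n ² ² * m * m                 ≡⟨ solve 2 (λ N m → N :* N :* m :* m := (N :* m) :* (N :* m)) refl (n ²) m ⟩
    (n ² * m) ²                   ≤⟨ ²-mono-≤ n²m≤qG ⟩
    (q * G) ²                     ≡⟨ ²-* q G ⟩
    q ² * G ²                     ≤⟨ *-monoʳ-≤ (q ²) G²≤ ⟩
    q ² * (k * m * (t ² * x))     ≡⟨ solve 4 (λ Q k m T → Q :* (k :* m :* T) := k :* Q :* T :* m) refl (q ²) k m (t ² * x) ⟩
    k * q ² * (t ² * x) * m       ∎)

  -- With `x = |X₀|`, `d = |X₀ + A + A|` and `s = |A + B|` this is the estimate for `A + A - A - A`: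
  -- `π x m⁴ ≤ d² m⁴ ≤ s⁴ x²`, after which `x ≤ m` removes the unknown size of `X₀`.
  quadruple-sums : ∀ π x m d s → 0 < x → 0 < m → x ≤ m → π * x ≤ d ² → d * m ² ≤ s ² * x →
    π * (m * m ²) ≤ s ² ²
  quadruple-sums π x m d s 0<x 0<m x≤m πx≤d² dm²≤s²x =
    *-cancelʳ-≤ _ _ m {{>-nonZero 0<m}} (*-cancelʳ-≤ _ _ x {{>-nonZero 0<x}} (begin
      π * (m * m ²) * m * x    ≡⟨ solve 3 (λ π m x → π :* (m :* (m :* m)) :* m :* x := π :* x :* ((m :* m) :* (m :* m))) refl π m x ⟩
      π * x * m ² ²            ≤⟨ *-monoˡ-≤ (m ² ²) πx≤d² ⟩
      d ² * m ² ²              ≡⟨ ²-* d (m ²) ⟨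
      (d * m ²) ²              ≤⟨ ²-mono-≤ dm²≤s²x ⟩
      (s ² * x) ²              ≡⟨ solve 2 (λ S x → (S :* x) :* (S :* x) := S :* S :* x :* x) refl (s ²) x ⟩
      s ² ² * x * x            ≤⟨ *-monoˡ-≤ x (*-monoʳ-≤ (s ² ²) x≤m) ⟩
      s ² ² * m * x            ∎))

  four-steps : ∀ π π₁ π₂ π₃ π₄ t s w → π * t ≤ s * π₁ → π₁ * t ≤ s * π₂ → π₂ * t ≤ w * π₃ → π₃ * t ≤ w * π₄ →
    π * t ² ² ≤ s ² * w ² * π₄
  four-steps π π₁ π₂ π₃ π₄ t s w h₁ h₂ h₃ h₄ = begin
    π * t ² ²                  ≡⟨ solve 2 (λ π t → π :* ((t :* t) :* (t :* t)) := π :* t :* (t :* t :* t)) refl π t ⟩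
    π * t * (t * t * t)        ≤⟨ *-monoˡ-≤ (t * t * t) h₁ ⟩
    s * π₁ * (t * t * t)       ≡⟨ solve 3 (λ s π t → s :* π :* (t :* t :* t) := s :* (t :* t) :* (π :* t)) refl s π₁ t ⟩
    s * (t * t) * (π₁ * t)     ≤⟨ *-monoʳ-≤ (s * (t * t)) h₂ ⟩
    s * (t * t) * (s * π₂)     ≡⟨ solve 3 (λ s π t → s :* (t :* t) :* (s :* π) := s :* s :* t :* (π :* t)) refl s π₂ t ⟩
    s * s * t * (π₂ * t)       ≤⟨ *-monoʳ-≤ (s * s * t) h₃ ⟩
    s * s * t * (w * π₃)       ≡⟨ solve 4 (λ s w π t → s :* s :* t :* (w :* π) := s :* s :* w :* (π :* t)) refl s w π₃ t ⟩
    s * s * w * (π₃ * t)       ≤⟨ *-monoʳ-≤ (s * s * w) h₄ ⟩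
    s * s * w * (w * π₄)       ≡⟨ solve 3 (λ s w π → s :* s :* w :* (w :* π) := (s :* s) :* (w :* w) :* π) refl s w π₄ ⟩
    s ² * w ² * π₄             ∎

  -- Squaring `levels` produces exactly the factor `t⁴x²` that `large` and `steps` bound above, so
  -- `t` and `x` disappear. What remains has degree 8 + 2 + 2 + 3 = 15 in set sizes against 4 + 10 =
  -- 14 in `q` and `s`.
  assemble : ∀ k l κ a n m q t x π π₄ s w →
    n ² ² * m ≤ k * q ² * (t ² * x) → π₄ * (m * m ²) ≤ s ² ² → w * a ≤ l * s ² →
    π * t ² ² ≤ s ² * w ² * π₄ → x ² ≤ κ * π →
    (n ² ² * m) ² * (a ² * (m * m ²)) ≤ k ² * l ² * κ * (q ² ² * (s ² * s ² ² * s ² ²))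
  assemble k l κ a n m q t x π π₄ s w levels sums double steps large = begin
    (n ² ² * m) ² * (a ² * μ)
      ≤⟨ *-monoˡ-≤ (a ² * μ) (²-mono-≤ levels) ⟩
    (k * q ² * (t ² * x)) ² * (a ² * μ)
      ≡⟨ solve 6 (λ k Q T x A μ → (k :* Q :* (T :* x)) :* (k :* Q :* (T :* x)) :* (A :* μ)
           := (k :* k) :* (Q :* Q) :* ((x :* x) :* (T :* T :* (A :* μ)))) refl k (q ²) (t ²) x (a ²) μ ⟩
    k ² * q ² ² * (x ² * (t ² ² * (a ² * μ)))
      ≤⟨ *-monoʳ-≤ (k ² * q ² ²) (*-monoˡ-≤ (t ² ² * (a ² * μ)) large) ⟩
    k ² * q ² ² * (κ * π * (t ² ² * (a ² * μ)))
      ≡⟨ solve 5 (λ K κ π T A → K :* (κ :* π :* (T :* A)) := K :* κ :* (π :* T :* A)) refl (k ² * q ² ²) κ π (t ² ²) (a ² * μ) ⟩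
    k ² * q ² ² * κ * (π * t ² ² * (a ² * μ))
      ≤⟨ *-monoʳ-≤ (k ² * q ² ² * κ) (*-monoˡ-≤ (a ² * μ) steps) ⟩
    k ² * q ² ² * κ * (s ² * w ² * π₄ * (a ² * μ))
      ≡⟨ cong (k ² * q ² ² * κ *_) (solve 5 (λ S w π a μ → S :* (w :* w) :* π :* ((a :* a) :* μ)
           := S :* ((w :* a) :* (w :* a)) :* (π :* μ)) refl (s ²) w π₄ a μ) ⟩
    k ² * q ² ² * κ * (s ² * (w * a) ² * (π₄ * μ))
      ≤⟨ *-monoʳ-≤ (k ² * q ² ² * κ) (*-mono-≤ (*-monoʳ-≤ (s ²) (²-mono-≤ double)) sums) ⟩
    k ² * q ² ² * κ * (s ² * (l * s ²) ² * s ² ²)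
      ≡⟨ solve 5 (λ K Q κ l S → K :* Q :* κ :* (S :* ((l :* S) :* (l :* S)) :* (S :* S))
           := K :* (l :* l) :* κ :* (Q :* (S :* (S :* S) :* (S :* S)))) refl (k ²) (q ² ²) κ l (s ²) ⟩
    k ² * l ² * κ * (q ² ² * (s ² * s ² ² * s ² ²)) ∎
    where
    μ : ℕ
    μ = m * m ²

  -- The split 15 = 8 + 2 + 5 follows the exponents of `n`, `a` and `m` on the left of the
  -- hypothesis, hence the factor `h⁸ c⁵`.
  to-powers : ∀ c h D a n m q s M → a ≤ h * n → a ≤ c * m → q ≤ M → s ≤ M →
    (n ² ² * m) ² * (a ² * (m * m ²)) ≤ D * (q ² ² * (s ² * s ² ² * s ² ²)) →
    a ^ 15 ≤ h ² ² ² * (c * c ² ²) * D * M ^ 14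
  to-powers c h D a n m q s M a≤hn a≤cm q≤M s≤M le = begin
    a ^ 15
      ≡⟨ pow15 a ⟩
    (a ² ²) ² * (a ² * (a * a ² ²))
      ≤⟨ *-mono-≤ (²-mono-≤ (²-mono-≤ (²-mono-≤ a≤hn))) (*-monoʳ-≤ (a ²) (*-mono-≤ a≤cm (²-mono-≤ (²-mono-≤ a≤cm)))) ⟩
    ((h * n) ² ²) ² * (a ² * (c * m * (c * m) ² ²))
      ≡⟨ regroup ⟩
    h ² ² ² * (c * c ² ²) * ((n ² ² * m) ² * (a ² * (m * m ²)))
      ≤⟨ *-monoʳ-≤ (h ² ² ² * (c * c ² ²)) le ⟩
    h ² ² ² * (c * c ² ²) * (D * (q ² ² * (s ² * s ² ² * s ² ²)))
      ≤⟨ *-monoʳ-≤ (h ² ² ² * (c * c ² ²)) (*-monoʳ-≤ D (*-mono-≤ (²-mono-≤ (²-mono-≤ q≤M))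
           (*-mono-≤ (*-mono-≤ (²-mono-≤ s≤M) (²-mono-≤ (²-mono-≤ s≤M))) (²-mono-≤ (²-mono-≤ s≤M))))) ⟩
    h ² ² ² * (c * c ² ²) * (D * (M ² ² * (M ² * M ² ² * M ² ²)))
      ≡⟨ *-assoc (h ² ² ² * (c * c ² ²)) D _ ⟨
    h ² ² ² * (c * c ² ²) * D * (M ² ² * (M ² * M ² ² * M ² ²))
      ≡⟨ cong (h ² ² ² * (c * c ² ²) * D *_) (pow14 M) ⟨
    h ² ² ² * (c * c ² ²) * D * M ^ 14 ∎
    where
    pow14 : ∀ x → x ^ 14 ≡ x ² ² * (x ² * x ² ² * x ² ²)
    pow14 = solve 1 (λ x → x :* (x :* (x :* (x :* (x :* (x :* (x :* (x :* (x :* (x :* (x :* (x :* (x :* (x :* con 1)))))))))))))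
      := ((x :* x) :* (x :* x)) :* ((x :* x) :* ((x :* x) :* (x :* x)) :* ((x :* x) :* (x :* x)))) refl
    pow15 : ∀ x → x ^ 15 ≡ (x ² ²) ² * (x ² * (x * x ² ²))
    pow15 = solve 1 (λ x → x :* (x :* (x :* (x :* (x :* (x :* (x :* (x :* (x :* (x :* (x :* (x :* (x :* (x :* (x :* con 1))))))))))))))
      := (((x :* x) :* (x :* x)) :* ((x :* x) :* (x :* x))) :* ((x :* x) :* (x :* ((x :* x) :* (x :* x))))) refl
    regroup : ((h * n) ² ²) ² * (a ² * (c * m * (c * m) ² ²)) ≡
      h ² ² ² * (c * c ² ²) * ((n ² ² * m) ² * (a ² * (m * m ²)))
    regroup = solve 5 (λ h n A c m →
      let sq = λ x → x :* x in
      sq (sq (sq (h :* n))) :* (A :* (c :* m :* sq (sq (c :* m))))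
      := sq (sq (sq h)) :* (c :* sq (sq c)) :* (sq (sq (sq n) :* m) :* (A :* (m :* sq m)))) refl h n (a ²) c m

module Constants where
  open import Data.Nat using (ℕ; suc; _+_; _*_; _^_)
  open Arithmetic using (_²)

  -- The 2 is the loss from `A` to `A′`, `2 c` the ratio of sizes after zero leaves `B`, 8 comes
  -- from the weak-type bound, 4 from the double sumset and `c⁴ + 1` from the pivot. The summand
  -- `c ^ 15` serves `B = {0}`.
  growth : ℕ → ℕ
  growth c = 2 ² ² ² * ((2 * c) * (2 * c) ² ²) * (8 ² * 4 ² * suc (c ² ²)) + c ^ 15

-- The sum-product estimate in a finite domain

module SumProduct (D : FiniteDomain) where

  open FiniteDomain D
  open Identities D
  open Arithmetic
  open Constants
  open import Algebra.Structures using (IsCommutativeSemiring)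
  open IsCommutativeSemiring isCommutativeSemiring using ()
    renaming (+-comm to ⊹-comm; +-assoc to ⊹-assoc; *-comm to ·-comm; zeroˡ to ·-zeroˡ)
  open import Data.Nat using (ℕ; zero; suc; _+_; _*_; _∸_; _/_; _^_; _≤_; _<_; _≤?_; _<?_; z≤n; s≤s; s≤s⁻¹;
    NonZero; >-nonZero; >-nonZero⁻¹)
  open import Data.Nat.Properties hiding (_≟_)
  open import Data.Nat.DivMod using (m/n*n≤m; m≡m%n+[m/n]*n; m%n≤n)
  open import Data.Nat.Solver using (module +-*-Solver)
  open +-*-Solver using (solve; _:=_; _:+_; _:*_; con)
  open import Data.List using (List; []; _∷_; _++_; map; filter)
  open import Data.List.Membership.Propositional using (_∈_; find; lose)
  open import Data.List.Membership.Propositional.Properties using (∈-map⁺; ∈-++⁺ˡ; ∈-++⁺ʳ)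
  open import Data.List.Membership.DecPropositional _≟_ using (_∈?_)
  open import Data.List.Relation.Unary.All as All using (All; []; _∷_)
  open import Data.List.Relation.Unary.Any using (Any; here; there; any?)
  open import Data.List.Relation.Unary.AllPairs using ([]; _∷_)
  open import Data.List.Relation.Unary.Unique.Propositional using (Unique)
  open import Data.Product using (Σ; ∃; ∃₂; _×_; _,_; proj₁; proj₂)
  open import Data.Product.Properties using (≡-dec)
  open import Data.Sum using (_⊎_; inj₁; inj₂; [_,_]′)
  open import Function using (_∘_)
  open import Level using (0ℓ)
  open import Relation.Nullary using (¬_; Dec; yes; no; contradiction)
  open import Relation.Nullary.Decidable using (¬?; _×-dec_)
  open import Relation.Unary using (Pred; Decidable)
  open import Relation.Binary.Definitions using (DecidableEquality)
  open import Relation.Binary.PropositionalEquality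

  -- Plünnecke inequalities

  infixl 6 _⊕_
  opaque

    _⊕_ : FinSet F → FinSet F → FinSet F
    A ⊕ B = image _≟_ (λ (a , b) → a ⊹ b) (A ×ˢ B)

    ∈-⊕⁺ : (A B : FinSet F) {a b : F} → a ∈ˢ A → b ∈ˢ B → a ⊹ b ∈ˢ (A ⊕ B)
    ∈-⊕⁺ A B a∈A b∈B = ∈-image⁺ _≟_ _ (A ×ˢ B) (∈-×⁺ A B a∈A b∈B)

    ∈-⊕⁻ : (A B : FinSet F) {z : F} → z ∈ˢ (A ⊕ B) → ∃₂ λ a b → a ∈ˢ A × b ∈ˢ B × z ≡ a ⊹ b
    ∈-⊕⁻ A B z∈ with ∈-image⁻ _≟_ _ (A ×ˢ B) z∈
    ... | (a , b) , ab∈ , refl = a , b , proj₁ (∈-×⁻ A B ab∈) , proj₂ (∈-×⁻ A B ab∈) , refl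

  ⊕-mono : (A A′ B B′ : FinSet F) → A ⊆ˢ A′ → B ⊆ˢ B′ → (A ⊕ B) ⊆ˢ (A′ ⊕ B′)
  ⊕-mono A A′ B B′ A⊆A′ B⊆B′ z∈ with ∈-⊕⁻ A B z∈
  ... | a , b , a∈A , b∈B , refl = ∈-⊕⁺ A′ B′ (A⊆A′ a∈A) (B⊆B′ b∈B)

  card-⊕-monoˡ : (A A′ B : FinSet F) → A ⊆ˢ A′ → card (A ⊕ B) ≤ card (A′ ⊕ B)
  card-⊕-monoˡ A A′ B A⊆A′ = card-mono (A ⊕ B) (A′ ⊕ B) (⊕-mono A A′ B B A⊆A′ (λ p → p))

  card-≤-⊕ : (A B : FinSet F) {b : F} → b ∈ˢ B → card A ≤ card (A ⊕ B)
  card-≤-⊕ A B {b} b∈B = card-≤-fun (_⊹ b) A (A ⊕ B) (λ p → ∈-⊕⁺ A B p b∈B) λ _ _ → ⊹-cancelʳ b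

  sublists : {T : Set} → List T → List (List T)
  sublists []       = [] ∷ []
  sublists (x ∷ xs) = map (x ∷_) (sublists xs) ++ sublists xs

  filter∈sublists : {T : Set} {P : Pred T 0ℓ} (P? : Decidable P) (xs : List T) → filter P? xs ∈ sublists xs
  filter∈sublists P? [] = here refl
  filter∈sublists P? (x ∷ xs) with P? x
  ... | yes _ = ∈-++⁺ˡ (∈-map⁺ (x ∷_) (filter∈sublists P? xs))
  ... | no  _ = ∈-++⁺ʳ (map (x ∷_) (sublists xs)) (filter∈sublists P? xs)

  -- Petridis' condition that no subset `Z` of `X` has a smaller ratio `|Z + B| / |Z|`,
  -- cross-multiplied so that an empty `Z` is harmless.
  Minimal : FinSet F → FinSet F → Set₁
  Minimal X B = {P : Pred F 0ℓ} (P? : Decidable P) →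
    card (X ⊕ B) * card (select P? X) ≤ card (select P? X ⊕ B) * card X

  opaque

    -- Descent: a subset of strictly smaller ratio replaces `A`. Strictness makes it a proper
    -- subset, so the size falls and the fuel `n` suffices; when no sublist improves the ratio, the
    -- current set is minimal.
    minimal-subset : (A B : FinSet F) → 0 < card A →
      Σ (FinSet F) λ X → X ⊆ˢ A × 0 < card X × card (X ⊕ B) * card A ≤ card (A ⊕ B) * card X × Minimal X B
    minimal-subset A B = go (card A) A ≤-refl
      where
      go : ∀ n A → card A ≤ n → 0 < card A →
        Σ (FinSet F) λ X → X ⊆ˢ A × 0 < card X × card (X ⊕ B) * card A ≤ card (A ⊕ B) * card X × Minimal X B
      go zero A A≤0 0<A = contradiction (≤-trans 0<A A≤0) λ ()
      go (suc n) A A≤n 0<A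
        with any? (λ zs → card (select (_∈? zs) A ⊕ B) * card A <? card (A ⊕ B) * card (select (_∈? zs) A))
                  (sublists (elems A))
      ... | no none = A , (λ p → p) , 0<A , ≤-refl , minimal
        where
        minimal : Minimal A B
        minimal P? = begin
          card (A ⊕ B) * card (select P? A)  ≤⟨ *-monoʳ-≤ (card (A ⊕ B)) (card-mono (select P? A) Z to) ⟩
          card (A ⊕ B) * card Z              ≤⟨ ≮⇒≥ (λ lt → none (lose (filter∈sublists P? (elems A)) lt)) ⟩
          card (Z ⊕ B) * card A              ≤⟨ *-monoˡ-≤ (card A) (card-⊕-monoˡ Z (select P? A) B from) ⟩
          card (select P? A ⊕ B) * card A    ∎
          where
          open ≤-Reasoning
          -- The exhaustive search ranges over lists, so `P?` is traded for membership in the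
          -- filtered list, which selects the same elements.
          Z : FinSet F
          Z = select (_∈? filter P? (elems A)) A
          to : select P? A ⊆ˢ Z
          to p = ∈-select⁺ (_∈? filter P? (elems A)) A (proj₁ (∈-select⁻ P? A p)) p
          from : Z ⊆ˢ select P? A
          from p = proj₂ (∈-select⁻ (_∈? filter P? (elems A)) A p)
      ... | yes some with find some
      ...   | zs , _ , lt = extend (go n Z (s≤s⁻¹ (≤-trans Z<A A≤n)) 0<Z)
        where
        open ≤-Reasoning
        Z Zᶜ : FinSet F
        Z  = select (_∈? zs) A
        Zᶜ = select (¬? ∘ (_∈? zs)) A
        Z⊆A : Z ⊆ˢ A
        Z⊆A p = proj₁ (∈-select⁻ (_∈? zs) A p)
        0<Z : 0 < card Z
        0<Z = >-nonZero⁻¹ (card Z) {{m*n≢0⇒n≢0 (card (A ⊕ B)) {{>-nonZero (≤-trans (s≤s z≤n) lt)}}}}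
        0<Zᶜ : 0 < card Zᶜ
        0<Zᶜ with 0 <? card Zᶜ
        ... | yes p = p
        ... | no ¬p = contradiction lt (≤⇒≯ (*-mono-≤ (card-⊕-monoˡ A Z B all) (card-mono Z A Z⊆A)))
          where
          all : A ⊆ˢ Z
          all {x} x∈A with x ∈? zs
          ... | yes x∈ = ∈-select⁺ (_∈? zs) A x∈A x∈
          ... | no  x∉ = contradiction (card-pos⁺ Zᶜ (∈-select⁺ (¬? ∘ (_∈? zs)) A x∈A x∉)) ¬p
        Z<A : card Z < card A
        Z<A = subst (card Z <_) (sym (card-select-split (_∈? zs) A)) (m<m+n (card Z) 0<Zᶜ)
        extend : (Σ (FinSet F) λ X → X ⊆ˢ Z × 0 < card X × card (X ⊕ B) * card Z ≤ card (Z ⊕ B) * card X × Minimal X B) →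
          Σ (FinSet F) λ X → X ⊆ˢ A × 0 < card X × card (X ⊕ B) * card A ≤ card (A ⊕ B) * card X × Minimal X B
        extend (X , X⊆Z , 0<X , ratio , min) = X , (λ p → Z⊆A (X⊆Z p)) , 0<X ,
          *-cancelʳ-≤ _ _ (card Z) {{>-nonZero 0<Z}} chain , min
          where
          swapʳ : ∀ a b c → a * b * c ≡ a * c * b
          swapʳ = solve 3 (λ a b c → a :* b :* c := a :* c :* b) refl
          chain : card (X ⊕ B) * card A * card Z ≤ card (A ⊕ B) * card X * card Z
          chain = begin
            card (X ⊕ B) * card A * card Z  ≡⟨ swapʳ (card (X ⊕ B)) (card A) (card Z) ⟩
            card (X ⊕ B) * card Z * card A  ≤⟨ *-monoˡ-≤ (card A) ratio ⟩
            card (Z ⊕ B) * card X * card A  ≡⟨ swapʳ (card (Z ⊕ B)) (card X) (card A) ⟩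
            card (Z ⊕ B) * card A * card X  ≤⟨ *-monoˡ-≤ (card X) (<⇒≤ lt) ⟩
            card (A ⊕ B) * card Z * card X  ≡⟨ swapʳ (card (A ⊕ B)) (card Z) (card X) ⟩
            card (A ⊕ B) * card X * card Z  ∎

  -- Induction on `C`. Let `Z` consist of the `y ∈ X` with `y + B + c ⊆ X + B + C`. Adjoining `c`
  -- adds at most `|X + B| - |Z + B|` elements to `X + B + C` and at least `|X| - |Z|` to `X + C`;
  -- minimality, applied to `Z`, compares the two gains.
  petridis : (X B : FinSet F) → Minimal X B → (C : FinSet F) →
    card ((X ⊕ B) ⊕ C) * card X ≤ card (X ⊕ B) * card (X ⊕ C)
  petridis X B min (mkFinSet [] []) = ≤-trans (*-monoˡ-≤ (card X) (card-mono ((X ⊕ B) ⊕ ∅) ∅ none)) z≤n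
    where
    ∅ : FinSet F
    ∅ = mkFinSet [] []
    none : ((X ⊕ B) ⊕ ∅) ⊆ˢ ∅
    none p with ∈-⊕⁻ (X ⊕ B) ∅ p
    ... | _ , _ , _ , () , _
  -- Adding `|Z + B| x` to both sides replaces the subtraction; `min P?` supplies this term at the
  -- end in exchange for `k |Z|`.
  petridis X B min (mkFinSet (c ∷ cs) (c∉ ∷ u)) = +-cancelʳ-≤ (card (Z ⊕ B) * x) _ _ (begin
    card (XB ⊕ C⁺) * x + card (Z ⊕ B) * x       ≡⟨ *-distribʳ-+ x (card (XB ⊕ C⁺)) _ ⟨
    (card (XB ⊕ C⁺) + card (Z ⊕ B)) * x         ≤⟨ *-monoˡ-≤ x upper ⟩
    (card (XB ⊕ C) + k) * x                     ≡⟨ *-distribʳ-+ x (card (XB ⊕ C)) k ⟩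
    card (XB ⊕ C) * x + k * x                   ≤⟨ +-monoˡ-≤ (k * x) (petridis X B min (mkFinSet cs u)) ⟩
    k * card (X ⊕ C) + k * x                    ≡⟨ *-distribˡ-+ k (card (X ⊕ C)) x ⟨
    k * (card (X ⊕ C) + x)                      ≤⟨ *-monoʳ-≤ k lower ⟩
    k * (card (X ⊕ C⁺) + card Z)                ≡⟨ *-distribˡ-+ k (card (X ⊕ C⁺)) (card Z) ⟩
    k * card (X ⊕ C⁺) + k * card Z              ≤⟨ +-monoʳ-≤ (k * card (X ⊕ C⁺)) (min P?) ⟩
    k * card (X ⊕ C⁺) + card (Z ⊕ B) * x        ∎)
    where
    open ≤-Reasoning
    C C⁺ XB : FinSet F
    C  = mkFinSet cs u
    C⁺ = mkFinSet (c ∷ cs) (c∉ ∷ u)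
    XB = X ⊕ B
    x = card X
    k = card XB
    P : Pred F 0ℓ
    P y = All (λ b → (y ⊹ b) ⊹ c ∈ elems (XB ⊕ C)) (elems B)
    P? : Decidable P
    P? y = All.all? (λ b → (y ⊹ b) ⊹ c ∈? elems (XB ⊕ C)) (elems B)
    Z Zᶜ : FinSet F
    Z  = select P? X
    Zᶜ = select (¬? ∘ P?) X
    Z⊆X : Z ⊆ˢ X
    Z⊆X p = proj₁ (∈-select⁻ P? X p)
    new? : Decidable (λ u → ¬ u ∈ elems (Z ⊕ B))
    new? u = ¬? (u ∈? elems (Z ⊕ B))
    old new shifted : FinSet F
    old     = select (λ u → u ∈? elems (Z ⊕ B)) XB
    new     = select new? XB
    shifted = image _≟_ (_⊹ c) new
    upper : card (XB ⊕ C⁺) + card (Z ⊕ B) ≤ card (XB ⊕ C) + k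
    upper = begin
      card (XB ⊕ C⁺) + card (Z ⊕ B)            ≤⟨ +-mono-≤ (card-union-≤ _≟_ (XB ⊕ C⁺) (XB ⊕ C) shifted cover)
                                                            (card-mono (Z ⊕ B) old keep) ⟩
      card (XB ⊕ C) + card shifted + card old  ≤⟨ +-monoˡ-≤ (card old) (+-monoʳ-≤ (card (XB ⊕ C)) shift) ⟩
      card (XB ⊕ C) + card new + card old      ≡⟨ +-assoc (card (XB ⊕ C)) (card new) (card old) ⟩
      card (XB ⊕ C) + (card new + card old)    ≡⟨ cong (card (XB ⊕ C) +_) (+-comm (card new) (card old)) ⟩
      card (XB ⊕ C) + (card old + card new)    ≡⟨ cong (card (XB ⊕ C) +_) (card-select-split (λ u → u ∈? elems (Z ⊕ B)) XB) ⟨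
      card (XB ⊕ C) + k                        ∎
      where
      keep : (Z ⊕ B) ⊆ˢ old
      keep p = ∈-select⁺ (λ u → u ∈? elems (Z ⊕ B)) XB (⊕-mono Z X B B Z⊆X (λ q → q) p) p
      shift : card shifted ≤ card new
      shift = card-≤ (λ v u → v ≡ u ⊹ c) shifted new (∈-image⁻ _≟_ (_⊹ c) new) (λ _ _ e e′ → trans e (sym e′))
      cover : ∀ {v} → v ∈ˢ (XB ⊕ C⁺) → v ∈ˢ (XB ⊕ C) ⊎ v ∈ˢ shifted
      cover p with ∈-⊕⁻ XB C⁺ p
      ... | u , c′ , u∈ , there c′∈ , refl = inj₁ (∈-⊕⁺ XB C u∈ c′∈)
      ... | u , _ , u∈ , here refl , refl with u ∈? elems (Z ⊕ B)
      ...   | no u∉ = inj₂ (∈-image⁺ _≟_ (_⊹ c) new (∈-select⁺ new? XB u∈ u∉))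
      ...   | yes u∈ZB with ∈-⊕⁻ Z B u∈ZB
      ...     | z , b , z∈Z , b∈B , refl = inj₁ (All.lookup (proj₂ (∈-select⁻ P? X z∈Z)) b∈B)
    lower : card (X ⊕ C) + x ≤ card (X ⊕ C⁺) + card Z
    lower = begin
      card (X ⊕ C) + x                     ≡⟨ cong (card (X ⊕ C) +_) (card-select-split P? X) ⟩
      card (X ⊕ C) + (card Z + card Zᶜ)    ≡⟨ cong (card (X ⊕ C) +_) (+-comm (card Z) (card Zᶜ)) ⟩
      card (X ⊕ C) + (card Zᶜ + card Z)    ≡⟨ +-assoc (card (X ⊕ C)) (card Zᶜ) (card Z) ⟨
      card (X ⊕ C) + card Zᶜ + card Z      ≤⟨ +-monoˡ-≤ (card Z) disjoint ⟩
      card (X ⊕ C⁺) + card Z               ∎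
      where
      Zᶜ+c : FinSet F
      Zᶜ+c = image _≟_ (_⊹ c) Zᶜ
      -- If `y + c = x′ + c′` then `y + b + c = x′ + b + c′` for every `b ∈ B`, which would put `y`
      -- into `Z`.
      apart : ∀ {v} → v ∈ˢ (X ⊕ C) → ¬ v ∈ˢ Zᶜ+c
      apart {v} v∈ v∈′ with ∈-⊕⁻ X C v∈ | ∈-image⁻ _≟_ (_⊹ c) Zᶜ v∈′
      ... | x′ , c′ , x′∈ , c′∈ , refl | y , y∈ , eq =
          proj₂ (∈-select⁻ (¬? ∘ P?) X y∈) (All.tabulate λ {b} b∈B →
            subst (_∈ elems (XB ⊕ C)) (sym (move b)) (∈-⊕⁺ XB C (∈-⊕⁺ X B x′∈ b∈B) c′∈))
        where
        swapʳ : ∀ p q r → (p ⊹ q) ⊹ r ≡ (p ⊹ r) ⊹ q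
        swapʳ p q r = trans (⊹-assoc p q r) (trans (cong (p ⊹_) (⊹-comm q r)) (sym (⊹-assoc p r q)))
        move : ∀ b → (y ⊹ b) ⊹ c ≡ (x′ ⊹ b) ⊹ c′
        move b = trans (swapʳ y b c) (trans (cong (_⊹ b) (sym eq)) (swapʳ x′ c′ b))
      disjoint : card (X ⊕ C) + card Zᶜ ≤ card (X ⊕ C⁺)
      disjoint with card-disjoint-union (X ⊕ C) Zᶜ+c apart
      ... | W , eq , _ , _ , split = begin
        card (X ⊕ C) + card Zᶜ      ≤⟨ +-monoʳ-≤ (card (X ⊕ C)) (card-≤-fun (_⊹ c) Zᶜ Zᶜ+c
                                         (∈-image⁺ _≟_ (_⊹ c) Zᶜ) λ _ _ → ⊹-cancelʳ c) ⟩
        card (X ⊕ C) + card Zᶜ+c    ≡⟨ eq ⟨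
        card W                      ≤⟨ card-mono W (X ⊕ C⁺) into ⟩
        card (X ⊕ C⁺)               ∎
        where
        into : W ⊆ˢ (X ⊕ C⁺)
        into p with split p
        ... | inj₁ q with ∈-⊕⁻ X C q
        ...   | _ , _ , x∈ , c∈ , refl = ∈-⊕⁺ X C⁺ x∈ (there c∈)
        into p | inj₂ q with ∈-image⁻ _≟_ (_⊹ c) Zᶜ q
        ...   | y , y∈ , refl = ∈-⊕⁺ X C⁺ (proj₁ (∈-select⁻ (¬? ∘ P?) X y∈)) (here refl)

  private
    cancel-ratio : ∀ t x k b s → 0 < x → t * x ≤ k * k → k * b ≤ s * x → t * (b * b) ≤ s * s * x
    cancel-ratio t x k b s 0<x tx≤kk kb≤sx = *-cancelʳ-≤ _ _ x {{>-nonZero 0<x}} (begin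
      t * (b * b) * x      ≡⟨ solve 3 (λ t b x → t :* (b :* b) :* x := t :* x :* (b :* b)) refl t b x ⟩
      t * x * (b * b)      ≤⟨ *-monoˡ-≤ (b * b) tx≤kk ⟩
      k * k * (b * b)      ≡⟨ solve 2 (λ k b → k :* k :* (b :* b) := (k :* b) :* (k :* b)) refl k b ⟩
      (k * b) * (k * b)    ≤⟨ *-mono-≤ kb≤sx kb≤sx ⟩
      (s * x) * (s * x)    ≡⟨ solve 2 (λ s x → (s :* x) :* (s :* x) := s :* s :* x :* x) refl s x ⟩
      s * s * x * x        ∎)
      where
      open ≤-Reasoning

  opaque

    -- Petridis with `C = B` gives `|X + B + B| |X| ≤ |X + B|²`, and the ratio `|X + B| / |X|` is at
    -- most `|A + B| / |A|`.
    small-double-sumset : (A B : FinSet F) → 0 < card A →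
      Σ (FinSet F) λ X → X ⊆ˢ A × 0 < card X ×
        card ((X ⊕ B) ⊕ B) * (card A * card A) ≤ card (A ⊕ B) * card (A ⊕ B) * card X
    small-double-sumset A B 0<A with minimal-subset A B 0<A
    ... | X , X⊆A , 0<X , ratio , min = X , X⊆A , 0<X ,
      cancel-ratio (card ((X ⊕ B) ⊕ B)) (card X) (card (X ⊕ B)) (card A) (card (A ⊕ B)) 0<X (petridis X B min B) ratio

  opaque

    -- Minimisers of the successive remainders are joined until they fill half of `A`. Before that
    -- the remainder has at least `|A| / 2` elements, which costs each piece the factor 4; the
    -- bounds add up because `|A′ + B + B|` is subadditive in `A′` and the right side additive.
    large-subset-small-double-sumset : (A B : FinSet F) →
      Σ (FinSet F) λ A′ → A′ ⊆ˢ A × card A ≤ 2 * card A′ ×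
        card ((A′ ⊕ B) ⊕ B) * (card A * card A) ≤ 4 * (card (A ⊕ B) * card (A ⊕ B)) * card A′
    large-subset-small-double-sumset A B = go a ∅ (λ ()) (≤-trans (*-monoˡ-≤ (a * a) empty) z≤n) ≤-refl
      where
      open ≤-Reasoning
      ∅ : FinSet F
      ∅ = mkFinSet [] []
      a s : ℕ
      a = card A
      s = card (A ⊕ B)
      Result : Set
      Result = Σ (FinSet F) λ A′ → A′ ⊆ˢ A × a ≤ 2 * card A′ ×
        card ((A′ ⊕ B) ⊕ B) * (a * a) ≤ 4 * (s * s) * card A′
      empty : card ((∅ ⊕ B) ⊕ B) ≤ 0
      empty = card-mono ((∅ ⊕ B) ⊕ B) ∅ none
        where
        none : ((∅ ⊕ B) ⊕ B) ⊆ˢ ∅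
        none p with ∈-⊕⁻ (∅ ⊕ B) B p
        ... | _ , _ , q , _ with ∈-⊕⁻ ∅ B q
        ...   | _ , _ , () , _
      module Step (A′ : FinSet F) (A′⊆A : A′ ⊆ˢ A) (small : 2 * card A′ < a)
        (bound : card ((A′ ⊕ B) ⊕ B) * (a * a) ≤ 4 * (s * s) * card A′) where
        rest : FinSet F
        rest = select (λ y → ¬? (y ∈? elems A′)) A
        a′ r : ℕ
        a′ = card A′
        r  = card rest
        rest⊆A : rest ⊆ˢ A
        rest⊆A p = proj₁ (∈-select⁻ (λ y → ¬? (y ∈? elems A′)) A p)
        a≤a′+r : a ≤ a′ + r
        a≤a′+r = begin
          a                                      ≡⟨ card-select-split (_∈? elems A′) A ⟩
          card (select (_∈? elems A′) A) + r     ≤⟨ +-monoˡ-≤ r (card-mono (select (_∈? elems A′) A) A′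
                                                     (λ p → proj₂ (∈-select⁻ (_∈? elems A′) A p))) ⟩
          a′ + r                                 ∎
        0<r : 0 < r
        0<r = +-cancelˡ-< a′ 0 r (begin-strict
          a′ + 0     ≤⟨ +-monoʳ-≤ a′ z≤n ⟩
          2 * a′     <⟨ small ⟩
          a          ≤⟨ a≤a′+r ⟩
          a′ + r     ∎)
        a≤2r : a ≤ 2 * r
        a≤2r = +-cancelˡ-≤ a a (2 * r) (begin
          a + a              ≡⟨ cong (a +_) (+-identityʳ a) ⟨
          2 * a              ≤⟨ *-monoʳ-≤ 2 a≤a′+r ⟩
          2 * (a′ + r)       ≡⟨ *-distribˡ-+ 2 a′ r ⟩
          2 * a′ + 2 * r     ≤⟨ +-monoˡ-≤ (2 * r) (<⇒≤ small) ⟩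
          a + 2 * r          ∎)
        bound-X : ∀ t x → t * (r * r) ≤ card (rest ⊕ B) * card (rest ⊕ B) * x → t * (a * a) ≤ 4 * (s * s) * x
        bound-X t x le = begin
          t * (a * a)                  ≤⟨ *-monoʳ-≤ t (*-mono-≤ a≤2r a≤2r) ⟩
          t * ((2 * r) * (2 * r))      ≡⟨ solve 2 (λ t r → t :* ((con 2 :* r) :* (con 2 :* r)) := con 4 :* (t :* (r :* r))) refl t r ⟩
          4 * (t * (r * r))            ≤⟨ *-monoʳ-≤ 4 (≤-trans le (*-monoˡ-≤ x (*-mono-≤ rest≤ rest≤))) ⟩
          4 * (s * s * x)              ≡⟨ *-assoc 4 (s * s) x ⟨
          4 * (s * s) * x              ∎
          where
          rest≤ : card (rest ⊕ B) ≤ s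
          rest≤ = card-⊕-monoˡ rest A B rest⊆A
        Extension : Set
        Extension = Σ (FinSet F) λ W → W ⊆ˢ A × a′ < card W × card ((W ⊕ B) ⊕ B) * (a * a) ≤ 4 * (s * s) * card W
        join : (X : FinSet F) → X ⊆ˢ rest → 0 < card X → card ((X ⊕ B) ⊕ B) * (a * a) ≤ 4 * (s * s) * card X → Extension
        join X X⊆rest 0<X X-bound with card-disjoint-union A′ X
              (λ p q → proj₂ (∈-select⁻ (λ y → ¬? (y ∈? elems A′)) A (X⊆rest q)) p)
        ... | W , |W| , _ , _ , W⊆ = W , W⊆A , subst (a′ <_) (sym |W|) (m<m+n a′ 0<X) , W-bound
          where
          W⊆A : W ⊆ˢ A
          W⊆A p with W⊆ p
          ... | inj₁ q = A′⊆A q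
          ... | inj₂ q = rest⊆A (X⊆rest q)
          union : ∀ {z} → z ∈ˢ ((W ⊕ B) ⊕ B) → z ∈ˢ ((A′ ⊕ B) ⊕ B) ⊎ z ∈ˢ ((X ⊕ B) ⊕ B)
          union p with ∈-⊕⁻ (W ⊕ B) B p
          ... | _ , _ , q , b∈ , refl with ∈-⊕⁻ W B q
          ...   | _ , _ , w∈ , b′∈ , refl with W⊆ w∈
          ...     | inj₁ w∈A′ = inj₁ (∈-⊕⁺ (A′ ⊕ B) B (∈-⊕⁺ A′ B w∈A′ b′∈) b∈)
          ...     | inj₂ w∈X  = inj₂ (∈-⊕⁺ (X ⊕ B) B (∈-⊕⁺ X B w∈X b′∈) b∈)
          W-bound : card ((W ⊕ B) ⊕ B) * (a * a) ≤ 4 * (s * s) * card W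
          W-bound = begin
            card ((W ⊕ B) ⊕ B) * (a * a)
              ≤⟨ *-monoˡ-≤ (a * a) (card-union-≤ _≟_ ((W ⊕ B) ⊕ B) ((A′ ⊕ B) ⊕ B) ((X ⊕ B) ⊕ B) union) ⟩
            (card ((A′ ⊕ B) ⊕ B) + card ((X ⊕ B) ⊕ B)) * (a * a)
              ≡⟨ *-distribʳ-+ (a * a) (card ((A′ ⊕ B) ⊕ B)) _ ⟩
            card ((A′ ⊕ B) ⊕ B) * (a * a) + card ((X ⊕ B) ⊕ B) * (a * a)
              ≤⟨ +-mono-≤ bound X-bound ⟩
            4 * (s * s) * a′ + 4 * (s * s) * card X
              ≡⟨ *-distribˡ-+ (4 * (s * s)) a′ (card X) ⟨
            4 * (s * s) * (a′ + card X)
              ≡⟨ cong (4 * (s * s) *_) |W| ⟨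
            4 * (s * s) * card W ∎
        extension : Extension
        extension =
          let X , X⊆rest , 0<X , XBB≤ = small-double-sumset rest B 0<r
          in join X X⊆rest 0<X (bound-X (card ((X ⊕ B) ⊕ B)) (card X) XBB≤)
      -- Every round enlarges `A′`, so `|A′| + fuel` never drops below `a`; with no fuel left `A′`
      -- would have `a` elements already.
      go : ∀ fuel (A′ : FinSet F) → A′ ⊆ˢ A → card ((A′ ⊕ B) ⊕ B) * (a * a) ≤ 4 * (s * s) * card A′ →
        a ≤ card A′ + fuel → Result
      go fuel A′ A′⊆A bound enough with a ≤? 2 * card A′
      ... | yes large = A′ , A′⊆A , large , bound
      go zero A′ A′⊆A bound enough | no small =
        contradiction (≤-trans enough (+-monoʳ-≤ (card A′) z≤n)) small
      go (suc fuel) A′ A′⊆A bound enough | no small = next (Step.extension A′ A′⊆A (≰⇒> small) bound)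
        where
        next : (Σ (FinSet F) λ W → W ⊆ˢ A × card A′ < card W × card ((W ⊕ B) ⊕ B) * (a * a) ≤ 4 * (s * s) * card W) →
          Result
        next (W , W⊆A , grows , W-bound) = go fuel W W⊆A W-bound (≤-trans enough
          (≤-trans (≤-reflexive (+-suc (card A′) fuel)) (+-monoˡ-≤ fuel grows)))

  -- Multiplicative energy and level sets

  hits? : {T : Set} (g : T → F) (Y : FinSet F) (t : F) → Decidable (λ π → Any (λ y → g π ⊹ y ≡ t) (elems Y))
  hits? g Y t π = any? (λ y → g π ⊹ y ≟ t) (elems Y)

  opaque

    -- For fixed `π` the translate `g π + Y` occupies `|Y|` values in `S`, so an average value `t`
    -- is met by `|Π| |Y| / |S|` of the `π`. Only the `π` are kept, each with some witness `y`.
    pigeonhole : {T : Set} (Π : FinSet T) (g : T → F) (Y S : FinSet F) →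
      (∀ {π y} → π ∈ˢ Π → y ∈ˢ Y → g π ⊹ y ∈ˢ S) →
      ∃ λ t → Σ (FinSet T) λ Π′ → Π′ ⊆ˢ Π × (∀ {π} → π ∈ˢ Π′ → ∃ λ y → y ∈ˢ Y × g π ⊹ y ≡ t) ×
        card Π * card Y ≤ card S * card Π′
    pigeonhole Π g Y S into with average-≤ 0# S (λ t → card (select (hits? g Y t) Π))
    ... | t , le = t , select (hits? g Y t) Π
        , (λ p → proj₁ (∈-select⁻ (hits? g Y t) Π p))
        , (λ p → find (proj₂ (∈-select⁻ (hits? g Y t) Π p)))
        , ≤-trans total le
      where
      open ≤-Reasoning
      total : card Π * card Y ≤ ∑ S λ t → card (select (hits? g Y t) Π)
      total = begin
        card Π * card Y                                ≡⟨ ∑-const Π (card Y) ⟨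
        ∑ Π (λ _ → card Y)                             ≤⟨ ∑-mono Π row ⟩
        ∑ Π (λ π → ∑ S λ t → 𝟙 (hits? g Y t π))            ≡⟨ ∑-swap Π S _ ⟩
        ∑ S (λ t → ∑ Π λ π → 𝟙 (hits? g Y t π))            ≡⟨ ∑-cong S (λ t → ∑-𝟙 (hits? g Y t) Π) ⟩
        ∑ S (λ t → card (select (hits? g Y t) Π))          ∎
        where
        row : ∀ {π} → π ∈ˢ Π → card Y ≤ ∑ S λ t → 𝟙 (hits? g Y t π)
        row {π} π∈ = ≤-trans
          (card-≤-fun (g π ⊹_) Y (select (λ t → hits? g Y t π) S)
            (λ y∈ → ∈-select⁺ (λ t → hits? g Y t π) S (into π∈ y∈) (lose y∈ refl))
            (λ _ _ e → ⊹-cancelʳ (g π) (trans (⊹-comm _ _) (trans e (⊹-comm _ _)))))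
          (≤-reflexive (sym (∑-𝟙 (λ t → hits? g Y t π) S)))

  argmax : (h : ℕ → ℕ) (n : ℕ) → ∃ λ t → ∀ {s} → s ≤ n → h s ≤ h t
  argmax h zero = 0 , λ {z≤n → ≤-refl}
  argmax h (suc n) with argmax h n
  ... | t , max with ≤-total (h t) (h (suc n))
  ...   | inj₁ le = suc n , λ s≤ → [ (λ s<1+n → ≤-trans (max (s≤s⁻¹ s<1+n)) le) , (λ {refl → ≤-refl}) ]′ (m≤n⇒m<n∨m≡n s≤)
  ...   | inj₂ ge = t , λ s≤ → [ (λ s<1+n → max (s≤s⁻¹ s<1+n)) , (λ {refl → ge}) ]′ (m≤n⇒m<n∨m≡n s≤)

  level : {T : Set} (B : FinSet T) (f : T → ℕ) → ℕ → FinSet T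
  level B f t = select (λ b → t ≤? f b) B

  -- `Q` bounds the square of the weak `L²` norm of `f`. On a set of size `|B|` that norm controls
  -- the sum: the part of `f` below a height `t` contributes at most `t |B|`, the part above at most
  -- `Q / t`.
  module Levels {T : Set} (B : FinSet T) (f : T → ℕ) (m : ℕ) (f≤m : ∀ {b} → b ∈ˢ B → f b ≤ m)
    (Q : ℕ) (weight≤Q : ∀ s → suc s * suc s * card (level B f (suc s)) ≤ Q) where

    open ≤-Reasoning

    -- Layer-cake remainder: the total size of all levels above `t`.
    tail : ℕ → ℕ
    tail t = ∑ B λ b → f b ∸ t

    tail-suc : ∀ t → tail t ≡ card (level B f (suc t)) + tail (suc t)
    tail-suc t = trans (∑-cong B λ b → peel (f b)) (trans (∑-+ B _ _)
      (cong (_+ tail (suc t)) (∑-𝟙 (λ b → suc t ≤? f b) B)))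
      where
      peel : ∀ k → k ∸ t ≡ 𝟙 (suc t ≤? k) + (k ∸ suc t)
      peel k with suc t ≤? k
      ... | yes t<k = sym (trans (sym (+-∸-assoc 1 t<k)) refl)
      ... | no  t≮k = trans (m≤n⇒m∸n≡0 (≮⇒≥ t≮k)) (sym (m≤n⇒m∸n≡0 (≤-trans (≮⇒≥ t≮k) (n≤1+n t))))

    tail-vanishes : ∀ {t} → m ≤ t → tail t ≤ 0
    tail-vanishes {t} m≤t = begin
      tail t          ≤⟨ ∑-mono B (λ b∈ → ≤-reflexive (m≤n⇒m∸n≡0 (≤-trans (f≤m b∈) m≤t))) ⟩
      ∑ B (λ _ → 0)   ≡⟨ trans (∑-const B 0) (*-zeroʳ (card B)) ⟩
      0               ∎

    -- Discrete form of ∫ₜ^∞ Q/s² ds = Q/t; the induction closes because t(t+2) ≤ (t+1)².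
    tail-bound : ∀ d t → m ≤ suc t + d → suc t * tail (suc t) ≤ Q
    -- Here `d` is the remaining distance to the ceiling `m`, above which the tail is empty; the
    -- induction therefore runs from the top down.
    tail-bound zero t m≤ = ≤-trans (*-monoʳ-≤ (suc t) (tail-vanishes (subst (m ≤_) (+-identityʳ (suc t)) m≤)))
      (≤-trans (≤-reflexive (*-zeroʳ (suc t))) z≤n)
    tail-bound (suc d) t m≤ = *-cancelˡ-≤ (u * u) (begin
      u * u * (v * tail v)                 ≡⟨ cong (λ w → u * u * (v * w)) (tail-suc v) ⟩
      u * u * (v * (c + tail u))           ≡⟨ solve 4 (λ u v c w → u :* u :* (v :* (c :+ w)) := v :* (u :* u :* c :+ u :* (u :* w))) refl u v c (tail u) ⟩
      v * (u * u * c + u * (u * tail u))   ≤⟨ *-monoʳ-≤ v (+-mono-≤ (weight≤Q v) (*-monoʳ-≤ u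
                                                (tail-bound d v (subst (m ≤_) (+-suc v d) m≤)))) ⟩
      v * (Q + u * Q)                      ≤⟨ m≤m+n _ Q ⟩
      v * (Q + u * Q) + Q                  ≡⟨ solve 2 (λ v Q → v :* (Q :+ (con 1 :+ v) :* Q) :+ Q := (con 1 :+ v) :* (con 1 :+ v) :* Q) refl v Q ⟩
      u * u * Q                            ∎)
      where
      u v c : ℕ
      v = suc t
      u = suc v
      c = card (level B f u)

    ∑-≤-tail : ∀ t → ∑ B f ≤ t * card B + tail t
    ∑-≤-tail t = begin
      ∑ B f                       ≤⟨ ∑-mono B (λ {b} _ → m≤n+m∸n (f b) t) ⟩
      ∑ B (λ b → t + (f b ∸ t))   ≡⟨ ∑-+ B (λ _ → t) _ ⟩
      ∑ B (λ _ → t) + tail t      ≡⟨ cong (_+ tail t) (trans (∑-const B t) (*-comm (card B) t)) ⟩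
      t * card B + tail t         ∎

    ∑≤2Q : ∑ B f ≤ 2 * Q
    ∑≤2Q = begin
      ∑ B f                              ≤⟨ ∑-≤-tail 0 ⟩
      tail 0                             ≡⟨ tail-suc 0 ⟩
      card (level B f 1) + tail 1        ≤⟨ +-mono-≤ (subst (_≤ Q) (*-identityˡ (card (level B f 1))) (weight≤Q 0))
                                              (subst (_≤ Q) (*-identityˡ (tail 1)) (tail-bound m 0 (n≤1+n m))) ⟩
      Q + Q                              ≡⟨ cong (Q +_) (+-identityʳ Q) ⟨
      2 * Q                              ∎

    -- The height is `t = ⌊G / 2|B|⌋` with `G = ∑ B f`, so that at most half of `G` lies below it
    -- and `t G ≤ 2 Q`. Rounding costs `t + 1 ≤ 2 t`; when `t` is zero, the bound `G ≤ 2 Q` takes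
    -- over.
    conclude : ∀ t → t * (2 * card B) ≤ ∑ B f → ∑ B f ≤ suc t * (2 * card B) → ∑ B f * ∑ B f ≤ 8 * card B * Q
    conclude zero _ G≤ = begin
      G * G                    ≤⟨ *-mono-≤ G≤ ∑≤2Q ⟩
      1 * (2 * b) * (2 * Q)    ≤⟨ m≤m+n _ (4 * (b * Q)) ⟩
      1 * (2 * b) * (2 * Q) + 4 * (b * Q)
                               ≡⟨ solve 2 (λ b Q → con 1 :* (con 2 :* b) :* (con 2 :* Q) :+ con 4 :* (b :* Q) := con 8 :* b :* Q) refl b Q ⟩
      8 * b * Q                ∎
      where
      G b : ℕ
      G = ∑ B f
      b = card B
    conclude t@(suc t′) ≤G G≤ = begin
      G * G                        ≤⟨ *-monoˡ-≤ G (≤-trans G≤ (*-monoˡ-≤ (2 * b) 1+t≤2t)) ⟩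
      2 * t * (2 * b) * G          ≡⟨ solve 3 (λ t b G → con 2 :* t :* (con 2 :* b) :* G := con 4 :* b :* (t :* G)) refl t b G ⟩
      4 * b * (t * G)              ≤⟨ *-monoʳ-≤ (4 * b) tG≤2Q ⟩
      4 * b * (2 * Q)              ≡⟨ solve 2 (λ b Q → con 4 :* b :* (con 2 :* Q) := con 8 :* b :* Q) refl b Q ⟩
      8 * b * Q                    ∎
      where
      G b : ℕ
      G = ∑ B f
      b = card B
      1+t≤2t : suc t ≤ 2 * t
      1+t≤2t = begin
        1 + t       ≤⟨ +-monoˡ-≤ t (s≤s (z≤n {t′})) ⟩
        t + t       ≡⟨ cong (t +_) (+-identityʳ t) ⟨
        2 * t       ∎
      tG≤2Q : t * G ≤ 2 * Q
      tG≤2Q = +-cancelˡ-≤ (t * G) _ _ (begin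
        t * G + t * G                    ≡⟨ solve 2 (λ t G → t :* G :+ t :* G := con 2 :* (t :* G)) refl t G ⟩
        2 * (t * G)                      ≤⟨ *-monoʳ-≤ 2 (*-monoʳ-≤ t (∑-≤-tail t)) ⟩
        2 * (t * (t * b + tail t))       ≡⟨ solve 3 (λ t b w → con 2 :* (t :* (t :* b :+ w)) := t :* (t :* (con 2 :* b)) :+ con 2 :* (t :* w)) refl t b (tail t) ⟩
        t * (t * (2 * b)) + 2 * (t * tail t)
                                         ≤⟨ +-mono-≤ (*-monoʳ-≤ t ≤G) (*-monoʳ-≤ 2 (tail-bound m t′ (m≤n+m m t))) ⟩
        t * G + 2 * Q                    ∎)

  -- The level returned maximises `t²|level t|`, so its weight can serve as `Q`. The search uses
  -- `suc s` to keep `t` positive and stops at `m`, above which levels are empty. The cutting height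
  -- passed to `conclude` is a separate number.
  heavy-level : {T : Set} (B : FinSet T) (f : T → ℕ) (m : ℕ) → 0 < card B → (∀ {b} → b ∈ˢ B → f b ≤ m) →
    ∃ λ t → 0 < t × ∑ B f * ∑ B f ≤ 8 * card B * (t * t * card (level B f t))
  heavy-level B f m 0<B f≤m with argmax (λ s → suc s * suc s * card (level B f (suc s))) m
  ... | t , max = suc t , s≤s z≤n , Levels.conclude B f m f≤m _ weight≤Q (G / (2 * card B))
        (m/n*n≤m G (2 * card B))
        (subst (_≤ suc (G / (2 * card B)) * (2 * card B)) (sym (m≡m%n+[m/n]*n G (2 * card B)))
          (+-monoˡ-≤ _ (m%n≤n G (2 * card B))))
    where
    G : ℕ
    G = ∑ B f
    instance
      2b≢0 : NonZero (2 * card B)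
      2b≢0 = >-nonZero (≤-trans 0<B (m≤m+n (card B) _))
    weight≤Q : ∀ s → suc s * suc s * card (level B f (suc s)) ≤ suc t * suc t * card (level B f (suc t))
    weight≤Q s with s ≤? m
    ... | yes s≤m = max s≤m
    ... | no  s≰m = ≤-trans (*-monoʳ-≤ (suc s * suc s) (card-mono (level B f (suc s)) (mkFinSet [] []) λ p →
            let b∈B , s<fb = ∈-select⁻ (λ b → suc s ≤? f b) B p
            in contradiction (≤-trans (n≤1+n s) (≤-trans s<fb (f≤m b∈B))) s≰m))
          (≤-trans (≤-reflexive (*-zeroʳ (suc s * suc s))) z≤n)

  ·-cancelʳ : ∀ b {x y} → b ≢ 0# → x · b ≡ y · b → x ≡ y
  ·-cancelʳ b {x} {y} b≢0 e = cross-cancel b≢0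
    (cong₂ _⊹_ (trans (·-comm b x) (trans e (·-comm y b))) (trans (·-zeroˡ y) (sym (·-zeroˡ x))))

  related? : (A : FinSet F) (b b₀ a : F) → Dec (Any (λ a′ → a · b ≡ a′ · b₀) (elems A))
  related? A b b₀ a = any? (λ a′ → a · b ≟ a′ · b₀) (elems A)

  -- The part of A that the dilation by b / b₀ keeps inside A.
  common : FinSet F → F → F → FinSet F
  common A b b₀ = select (related? A b b₀) A

  -- The multiplicative energy of `A` and `B` is at least `(|A||B|)² / |V|`. For fixed nonzero `b`,
  -- `b₀` the equation `a b = a′ b₀` determines `a′` from `a`, so the energy is at most
  -- `∑∑ |common A b b₀|`; an above-average `b₀` is taken.
  popular-base : (A B V : FinSet F) {b̂ : F} → b̂ ∈ˢ B → (∀ {b} → b ∈ˢ B → b ≢ 0#) →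
    (∀ {a b} → a ∈ˢ A → b ∈ˢ B → a · b ∈ˢ V) →
    ∃ λ b₀ → b₀ ∈ˢ B × card A * card A * card B ≤ card V * ∑ B (λ b → card (common A b b₀))
  popular-base A B V b̂∈B nz into with average-≤-∈ B (λ b₀ → ∑ B λ b → card (common A b b₀)) b̂∈B
  ... | b₀ , b₀∈B , E≤ = b₀ , b₀∈B , *-cancelˡ-≤ m {{>-nonZero (card-pos⁺ B b̂∈B)}} (begin
      m * (n * n * m)                    ≡⟨ solve 2 (λ m n → m :* (n :* n :* m) := (n :* m) :* (n :* m)) refl m n ⟩
      (n * m) * (n * m)                  ≡⟨ cong₂ _*_ (card-× A B) (card-× A B) ⟨
      card (A ×ˢ B) * card (A ×ˢ B)      ≤⟨ card²≤card*energy _≟_ (λ (a , b) → a · b) (A ×ˢ B) V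
                                              (λ p → let a∈ , b∈ = ∈-×⁻ A B p in into a∈ b∈) ⟩
      card V * energy _≟_ (λ (a , b) → a · b) (A ×ˢ B)
                                         ≤⟨ *-monoʳ-≤ (card V) (≤-trans rearranged E≤) ⟩
      card V * (m * G)                   ≡⟨ solve 3 (λ v m G → v :* (m :* G) := m :* (v :* G)) refl (card V) m G ⟩
      m * (card V * G)                   ∎)
    where
    open ≤-Reasoning
    m n G : ℕ
    m = card B
    n = card A
    G = ∑ B (λ b → card (common A b b₀))
    k : F → F → F → F → ℕ
    k a b a′ b′ = 𝟙 (a · b ≟ a′ · b′)
    row : ∀ b b′ → b′ ∈ˢ B → ∑ A (λ a → ∑ A λ a′ → k a b a′ b′) ≤ card (common A b b′)
    row b b′ b′∈B = begin
      ∑ A (λ a → ∑ A λ a′ → k a b a′ b′)         ≤⟨ ∑-mono A (λ {a} _ → ∑-𝟙-≤ (λ a′ → a · b ≟ a′ · b′) A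
                                                     (λ _ _ e e′ → ·-cancelʳ b′ (nz b′∈B) (trans (sym e) e′)) (related? A b b′ a)) ⟩
      ∑ A (λ a → 𝟙 (related? A b b′ a))          ≡⟨ ∑-𝟙 (related? A b b′) A ⟩
      card (common A b b′)                      ∎
    rearranged : energy _≟_ (λ (a , b) → a · b) (A ×ˢ B) ≤ ∑ B λ b₀ → ∑ B λ b → card (common A b b₀)
    rearranged = begin
      energy _≟_ (λ (a , b) → a · b) (A ×ˢ B)
        ≡⟨ ∑-× A B _ ⟩
      ∑ A (λ a → ∑ B λ b → ∑ (A ×ˢ B) λ (a′ , b′) → k a b a′ b′)
        ≡⟨ ∑-cong A (λ a → ∑-cong B λ b → trans (∑-× A B _) (∑-swap A B _)) ⟩
      ∑ A (λ a → ∑ B λ b → ∑ B λ b′ → ∑ A λ a′ → k a b a′ b′)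
        ≡⟨ ∑-swap A B _ ⟩
      ∑ B (λ b → ∑ A λ a → ∑ B λ b′ → ∑ A λ a′ → k a b a′ b′)
        ≡⟨ ∑-cong B (λ b → ∑-swap A B _) ⟩
      ∑ B (λ b → ∑ B λ b′ → ∑ A λ a → ∑ A λ a′ → k a b a′ b′)
        ≡⟨ ∑-swap B B _ ⟩
      ∑ B (λ b′ → ∑ B λ b → ∑ A λ a → ∑ A λ a′ → k a b a′ b′)
        ≤⟨ ∑-mono B (λ {b′} b′∈ → ∑-mono B λ {b} _ → row b b′ b′∈) ⟩
      ∑ B (λ b′ → ∑ B λ b → card (common A b b′)) ∎

  -- The pivot

  -- One representative for each value of `f`; it will cut `X × X` down to a set on which a map with
  -- few collisions is injective.
  section : {T U : Set} → DecidableEquality U → (f : T → U) (S : FinSet T) →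
    Σ (FinSet T) λ Π → Π ⊆ˢ S × (∀ {x y} → x ∈ˢ Π → y ∈ˢ Π → f x ≡ f y → x ≡ y) ×
      (∀ {s} → s ∈ˢ S → ∃ λ π → π ∈ˢ Π × f s ≡ f π)
  section {T} _≟ᵁ_ f (mkFinSet xs u) = go xs u
    where
    go : (xs : List T) → Unique xs →
      Σ (FinSet T) λ Π → (∀ {x} → x ∈ˢ Π → x ∈ xs) × (∀ {x y} → x ∈ˢ Π → y ∈ˢ Π → f x ≡ f y → x ≡ y) ×
        (∀ {s} → s ∈ xs → ∃ λ π → π ∈ˢ Π × f s ≡ f π)
    go [] _ = mkFinSet [] [] , (λ ()) , (λ ()) , λ ()
    go (x ∷ xs) (x∉ ∷ u) with go xs u
    ... | Π , Π⊆ , inj , cover with any? (λ π → f x ≟ᵁ f π) (elems Π)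
    ...   | yes some = Π , there ∘ Π⊆ , inj , λ { (here refl) → find some ; (there p) → cover p }
    ...   | no none = mkFinSet (x ∷ elems Π) (All.tabulate (λ p → All.lookup x∉ (Π⊆ p)) ∷ unique Π)
            , (λ { (here refl) → here refl ; (there p) → there (Π⊆ p) })
            , (λ { (here refl) (here refl) _ → refl
                 ; (here refl) (there q) e → contradiction (lose q e) none
                 ; (there p) (here refl) e → contradiction (lose p (sym e)) none
                 ; (there p) (there q) e → inj p q e })
            , λ { (here refl) → x , here refl , refl
                ; (there p) → let π , π∈ , e = cover p in π , there π∈ , e }

  -- Injectivity of `(b₁ - b₂) y + (b₃ - b₄) g` on `Π`, with the negative terms moved across.
  Separates : (b₁ b₂ b₃ b₄ : F) (g : F × F → F) → FinSet (F × F) → Set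
  Separates b₁ b₂ b₃ b₄ g Π = ∀ {π π′} → π ∈ˢ Π → π′ ∈ˢ Π →
    (b₁ · proj₂ π ⊹ b₃ · g π) ⊹ (b₂ · proj₂ π′ ⊹ b₄ · g π′) ≡
    (b₁ · proj₂ π′ ⊹ b₃ · g π′) ⊹ (b₂ · proj₂ π ⊹ b₄ · g π) → π ≡ π′

  -- (x , y) ↦ (b₁ - b₂) y + (b₃ - b₄) g (x , y) is injective on a positive proportion of X × X.
  record Pivot (X : FinSet F) (κ : ℕ) : Set where
    field
      {b₁ b₂ b₃ b₄} : F
      b₁∈ : b₁ ∈ˢ X
      b₂∈ : b₂ ∈ˢ X
      b₃∈ : b₃ ∈ˢ X
      b₄∈ : b₄ ∈ˢ X
      Π : FinSet (F × F)
      Π⊆ : Π ⊆ˢ X ×ˢ X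
      g : F × F → F
      g-form : (∀ π → g π ≡ proj₁ π) ⊎ (∀ π → g π ≡ proj₁ π ⊹ proj₂ π)
      large : card X * card X ≤ κ * card Π
      separates : Separates b₁ b₂ b₃ b₄ g Π

  module _ (X : FinSet F) where

    -- Membership of `ξ` in `(X - X) / (X - X)`, through `b₁ - b₂ = ξ (b₃ - b₄)`. Nested `Any` over
    -- the list of `X` keeps it decidable.
    Ratio : F → Set
    Ratio ξ = Any (λ b₁ → Any (λ b₂ → Any (λ b₃ → Any (λ b₄ →
      b₃ ≢ b₄ × b₁ ⊹ ξ · b₄ ≡ b₂ ⊹ ξ · b₃) (elems X)) (elems X)) (elems X)) (elems X)

    ratio? : Decidable Ratio
    ratio? ξ = any? (λ b₁ → any? (λ b₂ → any? (λ b₃ → any? (λ b₄ →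
      ¬? (b₃ ≟ b₄) ×-dec (b₁ ⊹ ξ · b₄ ≟ b₂ ⊹ ξ · b₃)) (elems X)) (elems X)) (elems X)) (elems X)

    -- A collision of `x + ξ y` exhibits `ξ = (x - x′) / (y′ - y)`. Hence a slope that is not a
    -- ratio makes the map injective on all of `X × X`.
    ratio⁺ : ∀ {ξ x y x′ y′} → (x , y) ∈ˢ (X ×ˢ X) → (x′ , y′) ∈ˢ (X ×ˢ X) → y ≢ y′ →
      x ⊹ ξ · y ≡ x′ ⊹ ξ · y′ → Ratio ξ
    ratio⁺ p q y≢y′ e with ∈-×⁻ X X p | ∈-×⁻ X X q
    ... | x∈ , y∈ | x′∈ , y′∈ = lose x∈ (lose x′∈ (lose y′∈ (lose y∈ (≢-sym y≢y′ , e))))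

    -- A one-point `X` has no ratios at all, but `X × X` is then a single pair and separation is
    -- automatic.
    pivot-trivial : ∀ {κ x} → x ∈ˢ X → (∀ {y z} → y ∈ˢ X → z ∈ˢ X → y ≡ z) → Pivot X (suc κ)
    pivot-trivial {κ} x∈ same = record
      { b₁∈ = x∈ ; b₂∈ = x∈ ; b₃∈ = x∈ ; b₄∈ = x∈
      ; Π = X ×ˢ X ; Π⊆ = λ p → p ; g = proj₁ ; g-form = inj₁ λ _ → refl
      ; large = ≤-trans (≤-reflexive (sym (card-× X X))) (m≤m+n _ _)
      ; separates = λ p q _ → let x∈ , y∈ = ∈-×⁻ X X p ; x′∈ , y′∈ = ∈-×⁻ X X q
                              in cong₂ _,_ (same x∈ x′∈) (same y∈ y′∈)
      }

    -- The coefficients come from the ratio `ξ`, injectivity from `ξ + 1`: with `g = x + y` the form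
    -- determines `x + (ξ + 1) y`, which has no collisions on `X × X`.
    pivot-escape : ∀ {κ ξ} → Ratio ξ → ¬ Ratio (ξ ⊹ 1#) → Pivot X (suc κ)
    pivot-escape {κ} {ξ} ratio escape with find ratio
    ... | b₁ , b₁∈ , r₁ with find r₁
    ...   | b₂ , b₂∈ , r₂ with find r₂
    ...     | b₃ , b₃∈ , r₃ with find r₃
    ...       | b₄ , b₄∈ , b₃≢b₄ , eq = record
      { b₁∈ = b₁∈ ; b₂∈ = b₂∈ ; b₃∈ = b₃∈ ; b₄∈ = b₄∈
      ; Π = X ×ˢ X ; Π⊆ = λ p → p ; g = λ (x , y) → x ⊹ y ; g-form = inj₂ λ _ → refl
      ; large = ≤-trans (≤-reflexive (sym (card-× X X))) (m≤m+n _ _)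
      ; separates = separates
      }
      where
      separates : Separates b₁ b₂ b₃ b₄ (λ (x , y) → x ⊹ y) (X ×ˢ X)
      separates {x , y} {x′ , y′} p q h = apart p q (trans (sym (shift-ratio ξ x y))
        (trans (ratio-transfer y (x ⊹ y) y′ (x′ ⊹ y′) b₃≢b₄ eq h) (shift-ratio ξ x′ y′)))
        where
        apart : ∀ {x y x′ y′} → (x , y) ∈ˢ (X ×ˢ X) → (x′ , y′) ∈ˢ (X ×ˢ X) →
          x ⊹ (ξ ⊹ 1#) · y ≡ x′ ⊹ (ξ ⊹ 1#) · y′ → (x , y) ≡ (x′ , y′)
        apart {x} {y} {x′} {y′} p q e with y ≟ y′
        ... | yes refl = cong (_, y) (⊹-cancelʳ _ e)
        ... | no y≢y′ = contradiction (ratio⁺ p q y≢y′ e) escape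

    line : F → F × F → F
    line ξ (x , y) = x ⊹ ξ · y

    _≟²_ : DecidableEquality (F × F)
    _≟²_ = ≡-dec _≟_ _≟_

    -- Equal pairs collide at every slope, distinct pairs at no more than one; distinct pairs with
    -- the same `y` never collide.
    line-collisions : ∀ s s′ → ∑ univ (λ ξ → 𝟙 (line ξ s ≟ line ξ s′)) ≤ card univ * 𝟙 (s ≟² s′) + 1
    line-collisions s@(x , y) s′@(x′ , y′) with s ≟² s′
    ... | yes _ = begin
      ∑ univ (λ ξ → 𝟙 (line ξ s ≟ line ξ s′))  ≤⟨ ∑-mono univ (λ {ξ} _ → 𝟙≤1 (line ξ s ≟ line ξ s′)) ⟩
      ∑ univ (λ _ → 1)                         ≡⟨ ∑-const univ 1 ⟩
      card univ * 1                            ≤⟨ m≤m+n _ 1 ⟩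
      card univ * 1 + 1                        ∎
      where open ≤-Reasoning
    ... | no s≢s′ = begin
      ∑ univ (λ ξ → 𝟙 (line ξ s ≟ line ξ s′))  ≤⟨ ∑-𝟙-≤ (λ ξ → line ξ s ≟ line ξ s′) univ once
                                                    (any? (λ ξ → line ξ s ≟ line ξ s′) (elems univ)) ⟩
      𝟙 (any? (λ ξ → line ξ s ≟ line ξ s′) (elems univ))
                                               ≤⟨ 𝟙≤1 (any? (λ ξ → line ξ s ≟ line ξ s′) (elems univ)) ⟩
      1                                        ≤⟨ m≤n+m 1 _ ⟩
      card univ * 0 + 1                        ∎
      where
      open ≤-Reasoning
      once : ∀ {ξ ξ′} → ξ ∈ˢ univ → ξ′ ∈ˢ univ → line ξ s ≡ line ξ s′ → line ξ′ s ≡ line ξ′ s′ → ξ ≡ ξ′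
      once _ _ e e′ with y ≟ y′
      ... | yes refl = contradiction (cong (_, y) (⊹-cancelʳ _ e)) s≢s′
      ... | no y≢y′ = ratio-unique x y x′ y′ y≢y′ e e′

    total-energy : ∑ univ (λ ξ → energy _≟_ (line ξ) (X ×ˢ X)) ≤
      card univ * card (X ×ˢ X) + card (X ×ˢ X) * card (X ×ˢ X)
    total-energy = begin
      ∑ univ (λ ξ → ∑ S λ s → ∑ S λ s′ → 𝟙 (line ξ s ≟ line ξ s′))
        ≡⟨ ∑-swap univ S _ ⟩
      ∑ S (λ s → ∑ univ λ ξ → ∑ S λ s′ → 𝟙 (line ξ s ≟ line ξ s′))
        ≡⟨ ∑-cong S (λ s → ∑-swap univ S _) ⟩
      ∑ S (λ s → ∑ S λ s′ → ∑ univ λ ξ → 𝟙 (line ξ s ≟ line ξ s′))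
        ≤⟨ ∑-mono S (λ {s} _ → ∑-mono S λ {s′} _ → line-collisions s s′) ⟩
      ∑ S (λ s → ∑ S λ s′ → p * 𝟙 (s ≟² s′) + 1)
        ≤⟨ ∑-mono S (λ {s} _ → row s) ⟩
      ∑ S (λ _ → p + q)
        ≡⟨ ∑-const S (p + q) ⟩
      q * (p + q)
        ≡⟨ trans (*-distribˡ-+ q p q) (cong (_+ q * q) (*-comm q p)) ⟩
      p * q + q * q ∎
      where
      open ≤-Reasoning
      S : FinSet (F × F)
      S = X ×ˢ X
      p q : ℕ
      p = card univ
      q = card S
      row : ∀ s → ∑ S (λ s′ → p * 𝟙 (s ≟² s′) + 1) ≤ p + q
      row s = begin
        ∑ S (λ s′ → p * 𝟙 (s ≟² s′) + 1)            ≡⟨ ∑-+ S _ (λ _ → 1) ⟩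
        ∑ S (λ s′ → p * 𝟙 (s ≟² s′)) + ∑ S (λ _ → 1)
                                                   ≡⟨ cong₂ _+_ (∑-*ˡ S p _) (trans (∑-const S 1) (*-identityʳ q)) ⟩
        p * ∑ S (λ s′ → 𝟙 (s ≟² s′)) + q           ≤⟨ +-monoˡ-≤ q (*-monoʳ-≤ p (≤-trans
                                                        (∑-𝟙-≤ (s ≟²_) S (λ _ _ e e′ → trans (sym e) e′) (any? (s ≟²_) (elems S)))
                                                        (𝟙≤1 (any? (s ≟²_) (elems S))))) ⟩
        p * 1 + q                                  ≡⟨ cong (_+ q) (*-identityʳ p) ⟩
        p + q                                      ∎

    -- With `p = |F|` and `q = |X|²`, the total energy is at most `p q + q²`, so some slope has
    -- energy at most `q + q²/p`. Here `|X|² ≤ e p` enters.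
    low-energy-line : ∀ {e} → card X * card X ≤ e * card univ →
      ∃ λ ξ → energy _≟_ (line ξ) (X ×ˢ X) ≤ suc e * card (X ×ˢ X)
    low-energy-line {e} small with average-≥-∈ univ (λ ξ → energy _≟_ (line ξ) (X ×ˢ X)) (complete 0#)
    ... | ξ , _ , avg = ξ , *-cancelˡ-≤ p {{>-nonZero (card-pos⁺ univ (complete 0#))}} (begin
      p * energy _≟_ (line ξ) (X ×ˢ X)  ≤⟨ ≤-trans avg total-energy ⟩
      p * q + q * q                     ≤⟨ +-monoʳ-≤ (p * q) (*-monoʳ-≤ q (subst (_≤ e * p) (sym (card-× X X)) small)) ⟩
      p * q + q * (e * p)               ≡⟨ solve 3 (λ p q e → p :* q :+ q :* (e :* p) := p :* ((con 1 :+ e) :* q)) refl p q e ⟩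
      p * (suc e * q)                   ∎)
      where
      open ≤-Reasoning
      p q : ℕ
      p = card univ
      q = card (X ×ˢ X)

    -- Low energy forces `x + ξ y` to take at least `|X|² / (e + 1)` values, and one representative
    -- of each forms `Π`. Since every slope is a ratio, this `ξ` has coefficients in `X`.
    pivot-full : ∀ {e x} → x ∈ˢ X → card X * card X ≤ e * card univ → (∀ ξ → Ratio ξ) → Pivot X (suc e)
    pivot-full {e} {x} x∈ small full =
      let ξ , E≤ = low-energy-line {e} small in build ξ E≤ (section _≟_ (line ξ) (X ×ˢ X))
      where
      build : ∀ ξ → energy _≟_ (line ξ) (X ×ˢ X) ≤ suc e * card (X ×ˢ X) →
        (Σ (FinSet (F × F)) λ Π → Π ⊆ˢ X ×ˢ X × (∀ {x y} → x ∈ˢ Π → y ∈ˢ Π → line ξ x ≡ line ξ y → x ≡ y) ×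
          (∀ {s} → s ∈ˢ (X ×ˢ X) → ∃ λ π → π ∈ˢ Π × line ξ s ≡ line ξ π)) → Pivot X (suc e)
      build ξ E≤ (Π , Π⊆ , inj , cover) with find (full ξ)
      ... | b₁ , b₁∈ , r₁ with find r₁
      ...   | b₂ , b₂∈ , r₂ with find r₂
      ...     | b₃ , b₃∈ , r₃ with find r₃
      ...       | b₄ , b₄∈ , b₃≢b₄ , eq = record
        { b₁∈ = b₁∈ ; b₂∈ = b₂∈ ; b₃∈ = b₃∈ ; b₄∈ = b₄∈
        ; Π = Π ; Π⊆ = Π⊆ ; g = proj₁ ; g-form = inj₁ λ _ → refl
        ; large = subst (_≤ suc e * card Π) (card-× X X) large
        ; separates = λ {π} {π′} p q h →
            inj p q (ratio-transfer (proj₂ π) (proj₁ π) (proj₂ π′) (proj₁ π′) b₃≢b₄ eq h)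
        }
        where
        open ≤-Reasoning
        q : ℕ
        q = card (X ×ˢ X)
        V : FinSet F
        V = image _≟_ (line ξ) Π
        into : ∀ {s} → s ∈ˢ (X ×ˢ X) → line ξ s ∈ˢ V
        into s∈ = let π , π∈ , e = cover s∈ in subst (_∈ˢ V) (sym e) (∈-image⁺ _≟_ (line ξ) Π π∈)
        V≤Π : card V ≤ card Π
        V≤Π = card-≤ (λ v π → v ≡ line ξ π) V Π (∈-image⁻ _≟_ (line ξ) Π) (λ _ _ e e′ → trans e (sym e′))
        large : q ≤ suc e * card Π
        large = *-cancelʳ-≤ q _ q {{>-nonZero (card-pos⁺ (X ×ˢ X) (∈-×⁺ X X x∈ x∈))}} (begin
          q * q                          ≤⟨ card²≤card*energy _≟_ (line ξ) (X ×ˢ X) V into ⟩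
          card V * energy _≟_ (line ξ) (X ×ˢ X)
                                         ≤⟨ *-mono-≤ V≤Π E≤ ⟩
          card Π * (suc e * q)           ≡⟨ solve 3 (λ π k q → π :* (k :* q) := k :* π :* q) refl (card Π) (suc e) q ⟩
          suc e * card Π * q             ∎)

  opaque

    -- Zero is a ratio as soon as `X` has two elements. From there either adding 1 leads out of the
    -- ratios at some point, or the ratios are closed under adding 1 and exhaust the domain.
    pivot : ∀ (X : FinSet F) {e x} → x ∈ˢ X → card X * card X ≤ e * card univ → Pivot X (suc e)
    pivot X {e} {x} x∈ small with ratio? X 0#
    ... | no none = pivot-trivial X x∈ same
      where
      same : ∀ {y z} → y ∈ˢ X → z ∈ˢ X → y ≡ z
      same {y} {z} y∈ z∈ with y ≟ z
      ... | yes e = e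
      ... | no y≢z = contradiction (ratio⁺ X (∈-×⁺ X X x∈ y∈) (∈-×⁺ X X x∈ z∈) y≢z
            (cong (x ⊹_) (trans (·-zeroˡ y) (sym (·-zeroˡ z))))) none
    ... | yes start with any? (λ ξ → ratio? X ξ ×-dec ¬? (ratio? X (ξ ⊹ 1#))) (elems univ)
    ...   | yes some = let ξ , _ , ratio , escape = find some in pivot-escape X ratio escape
    ...   | no none = pivot-full X x∈ small (1#-generates (Ratio X) start step)
      where
      step : ∀ ξ → Ratio X ξ → Ratio X (ξ ⊹ 1#)
      step ξ r with ratio? X (ξ ⊹ 1#)
      ... | yes r′ = r′
      ... | no ¬r′ = contradiction (lose (complete ξ) (r , ¬r′)) none

  -- The collapse of (b₁ - b₂) y + (b₃ - b₄) g into A + A - A - A, and the final count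

  -- States that `b z` lies in the translate `b t - b₀ A`.
  Hit : FinSet F → (b₀ b z t : F) → Set
  Hit A b₀ b z t = ∃ λ a → a ∈ˢ A × b · z ⊹ b₀ · a ≡ b · t

  -- Ruzsa's triangle argument `|X| |S - S| ≤ |X + S|²` for `S = A + A`, applied to `Π` directly
  -- instead of its image in `S - S`. This `X` is an auxiliary set of translates, not the level set.
  module Collapse (A X : FinSet F) {b₀ b₁ b₂ b₃ b₄ t₁ t₂ t₃ t₄ : F} (b₀≢0 : b₀ ≢ 0#) (g : F × F → F)
    (Π : FinSet (F × F)) (separates : Separates b₁ b₂ b₃ b₄ g Π)
    (hits : ∀ {π} → π ∈ˢ Π → Hit A b₀ b₁ (proj₂ π) t₁ × Hit A b₀ b₂ (proj₂ π) t₂ ×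
                             Hit A b₀ b₃ (g π) t₃ × Hit A b₀ b₄ (g π) t₄) where

    private
      XAA : FinSet F
      XAA = (X ⊕ A) ⊕ A

      -- A relation, since the `aᵢ` come only as witnesses of hits. Cancelling `b₀` shows afterwards
      -- that `π` determines them.
      record Sums (πx : (F × F) × F) (uv : F × F) : Set where
        constructor sums
        field
          {a₁ a₂ a₃ a₄} : F
          e₁ : b₁ · proj₂ (proj₁ πx) ⊹ b₀ · a₁ ≡ b₁ · t₁
          e₂ : b₂ · proj₂ (proj₁ πx) ⊹ b₀ · a₂ ≡ b₂ · t₂
          e₃ : b₃ · g (proj₁ πx) ⊹ b₀ · a₃ ≡ b₃ · t₃
          e₄ : b₄ · g (proj₁ πx) ⊹ b₀ · a₄ ≡ b₄ · t₄
          u≡ : proj₁ uv ≡ (proj₂ πx ⊹ a₂) ⊹ a₄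
          v≡ : proj₂ uv ≡ (proj₂ πx ⊹ a₁) ⊹ a₃

      total : ∀ {πx} → πx ∈ˢ (Π ×ˢ X) → ∃ λ uv → uv ∈ˢ (XAA ×ˢ XAA) × Sums πx uv
      total p with ∈-×⁻ Π X p
      ... | π∈ , x∈ with hits π∈
      ...   | (a₁ , a₁∈ , e₁) , (a₂ , a₂∈ , e₂) , (a₃ , a₃∈ , e₃) , (a₄ , a₄∈ , e₄) =
        _ , ∈-×⁺ XAA XAA (∈-⊕⁺ (X ⊕ A) A (∈-⊕⁺ X A x∈ a₂∈) a₄∈) (∈-⊕⁺ (X ⊕ A) A (∈-⊕⁺ X A x∈ a₁∈) a₃∈)
          , sums e₁ e₂ e₃ e₄ refl refl

      same-a : ∀ {b z a a′ t} → b · z ⊹ b₀ · a ≡ b · t → b · z ⊹ b₀ · a′ ≡ b · t → a ≡ a′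
      same-a {b} {z} {a} {a′} e e′ = ·-cancelʳ b₀ b₀≢0 (trans (·-comm a b₀) (trans
        (⊹-cancelʳ (b · z) (trans (⊹-comm (b₀ · a) (b · z)) (trans e (trans (sym e′) (⊹-comm (b · z) (b₀ · a′))))))
        (·-comm b₀ a′)))

      same-x : ∀ {π x x′ uv} → Sums (π , x) uv → Sums (π , x′) uv → x ≡ x′
      same-x (sums {a₁} {_} {a₃} e₁ _ e₃ _ _ v≡) (sums e₁′ _ e₃′ _ _ v≡′) with same-a e₁ e₁′ | same-a e₃ e₃′
      ... | refl | refl = ⊹-cancelʳ a₁ (⊹-cancelʳ a₃ (trans (sym v≡) v≡′))

      injective : ∀ {πx πx′ uv} → πx ∈ˢ (Π ×ˢ X) → πx′ ∈ˢ (Π ×ˢ X) → Sums πx uv → Sums πx′ uv → πx ≡ πx′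
      injective {π , x} {π′ , x′} p p′ S@(sums e₁ e₂ e₃ e₄ u≡ v≡) S′@(sums e₁′ e₂′ e₃′ e₄′ u≡′ v≡′) =
        merge (separates (proj₁ (∈-×⁻ Π X p)) (proj₁ (∈-×⁻ Π X p′))
          (combine-hits (trans e₁ (sym e₁′)) (trans e₂ (sym e₂′)) (trans e₃ (sym e₃′)) (trans e₄ (sym e₄′))
            (eliminate-translate (trans (sym u≡) u≡′) (trans (sym v≡) v≡′)))) S S′
        where
        merge : ∀ {π π′ x x′ uv} → π ≡ π′ → Sums (π , x) uv → Sums (π′ , x′) uv → (π , x) ≡ (π′ , x′)
        merge {π} refl S S′ = cong (π ,_) (same-x S S′)

    -- Both sums u = x + a₂ + a₄ and v = x + a₁ + a₃ are recorded, so that u - v recovers π by separation.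
    bound : card Π * card X ≤ card XAA * card XAA
    bound = subst₂ _≤_ (card-× Π X) (card-× XAA XAA) (card-≤ Sums (Π ×ˢ X) (XAA ×ˢ XAA) total injective)

  opaque

    -- The terms with `b₁`, `b₂` are pigeonholed in `A + B`, those with `b₃`, `b₄` in a set of size
    -- at most `|A′ + B + B|`. The translates `X₀` for the collapse are a subset of `B` with
    -- `|X₀ + A + A|` small.
    dilated-sums : ∀ {κ t b₀} (A A′ B X : FinSet F) → A′ ⊆ˢ A → X ⊆ˢ B → b₀ ≢ 0# →
      (∀ {b} → b ∈ˢ X → t ≤ card (common A′ b b₀)) → (P : Pivot X κ) →
      ∃ λ π₄ → card (Pivot.Π P) * t ² ² ≤ card (A ⊕ B) ² * card ((A′ ⊕ B) ⊕ B) ² * π₄ ×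
        π₄ * (card B * card B ²) ≤ card (A ⊕ B) ² ²
    dilated-sums {κ} {t} {b₀} A A′ B X A′⊆A X⊆B b₀≢0 popular P
      with small-double-sumset B A (card-pos⁺ B (X⊆B (Pivot.b₁∈ P)))
    ... | X₀ , X₀⊆B , 0<X₀ , ratio = run
      where
      open Pivot P
      s w m d : ℕ
      s = card (A ⊕ B)
      w = card ((A′ ⊕ B) ⊕ B)
      m = card B
      d = card ((X₀ ⊕ A) ⊕ A)

      coords : ∀ {π} → π ∈ˢ Π → proj₁ π ∈ˢ B × proj₂ π ∈ˢ B
      coords π∈ = let x∈ , y∈ = ∈-×⁻ X X (Π⊆ π∈) in X⊆B x∈ , X⊆B y∈

      common⊆ : ∀ b {y} → y ∈ˢ common A′ b b₀ → y ∈ˢ A′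
      common⊆ b p = proj₁ (∈-select⁻ (related? A′ b b₀) A′ p)

      second-sums : ∀ b {π y} → π ∈ˢ Π → y ∈ˢ common A′ b b₀ → proj₂ π ⊹ y ∈ˢ (A ⊕ B)
      second-sums b {π} {y} π∈ y∈ = subst (_∈ˢ (A ⊕ B)) (⊹-comm y (proj₂ π))
        (∈-⊕⁺ A B (A′⊆A (common⊆ b y∈)) (proj₂ (coords π∈)))

      g-sums : ∃ λ W → card W ≤ w × (∀ {π y} → π ∈ˢ Π → y ∈ˢ A′ → g π ⊹ y ∈ˢ W)
      g-sums with g-form
      -- For `g = x` the sums lie in `A′ + B`, which is no larger than `A′ + B + B`; both shapes of
      -- `g` then share the bound `w`.
      ... | inj₁ first = A′ ⊕ B , card-≤-⊕ (A′ ⊕ B) B (X⊆B b₁∈) , λ {π} {y} π∈ y∈ →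
              subst (_∈ˢ (A′ ⊕ B)) (trans (⊹-comm y (proj₁ π)) (cong (_⊹ y) (sym (first π))))
                (∈-⊕⁺ A′ B y∈ (proj₁ (coords π∈)))
      ... | inj₂ both = (A′ ⊕ B) ⊕ B , ≤-refl , λ {π} {y} π∈ y∈ →
              subst (_∈ˢ ((A′ ⊕ B) ⊕ B))
                (trans (⊹-assoc y (proj₁ π) (proj₂ π)) (trans (⊹-comm y _) (cong (_⊹ y) (sym (both π)))))
                (∈-⊕⁺ (A′ ⊕ B) B (∈-⊕⁺ A′ B y∈ (proj₁ (coords π∈))) (proj₂ (coords π∈)))

      to-hit : ∀ b {z t} → (∃ λ y → y ∈ˢ common A′ b b₀ × z ⊹ y ≡ t) → Hit A b₀ b z t
      to-hit b (y , y∈ , e) with find (proj₂ (∈-select⁻ (related? A′ b b₀) A′ y∈))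
      ... | a , a∈ , e′ = a , A′⊆A a∈ , hit e e′

      run : ∃ λ π₄ → card Π * t ² ² ≤ s ² * w ² * π₄ × π₄ * (m * m ²) ≤ s ² ²
      run =
        -- The four selections are nested, so every element of the last set inherits the hits of all
        -- earlier ones.
        let W , W≤w , into = g-sums
            t₁ , Π₁ , Π₁⊆ , hit₁ , le₁ = pigeonhole Π proj₂ (common A′ b₁ b₀) (A ⊕ B) (second-sums b₁)
            t₂ , Π₂ , Π₂⊆ , hit₂ , le₂ = pigeonhole Π₁ proj₂ (common A′ b₂ b₀) (A ⊕ B)
              (λ π∈ → second-sums b₂ (Π₁⊆ π∈))
            t₃ , Π₃ , Π₃⊆ , hit₃ , le₃ = pigeonhole Π₂ g (common A′ b₃ b₀) W
              (λ π∈ y∈ → into (Π₁⊆ (Π₂⊆ π∈)) (common⊆ b₃ y∈))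
            t₄ , Π₄ , Π₄⊆ , hit₄ , le₄ = pigeonhole Π₃ g (common A′ b₄ b₀) W
              (λ π∈ y∈ → into (Π₁⊆ (Π₂⊆ (Π₃⊆ π∈))) (common⊆ b₄ y∈))
        in card Π₄
         , four-steps (card Π) (card Π₁) (card Π₂) (card Π₃) (card Π₄) t s w
             (≤-trans (*-monoʳ-≤ (card Π) (popular b₁∈)) le₁)
             (≤-trans (*-monoʳ-≤ (card Π₁) (popular b₂∈)) le₂)
             (≤-trans (≤-trans (*-monoʳ-≤ (card Π₂) (popular b₃∈)) le₃) (*-monoˡ-≤ (card Π₃) W≤w))
             (≤-trans (≤-trans (*-monoʳ-≤ (card Π₃) (popular b₄∈)) le₄) (*-monoˡ-≤ (card Π₄) W≤w))
         , quadruple-sums (card Π₄) (card X₀) m d s 0<X₀ (card-pos⁺ B (X⊆B b₁∈)) (card-mono X₀ B X₀⊆B)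
             (Collapse.bound A X₀ b₀≢0 g Π₄
               (λ π∈ π′∈ → separates (Π₁⊆ (Π₂⊆ (Π₃⊆ (Π₄⊆ π∈)))) (Π₁⊆ (Π₂⊆ (Π₃⊆ (Π₄⊆ π′∈)))))
               (λ π∈ → to-hit b₁ (hit₁ (Π₂⊆ (Π₃⊆ (Π₄⊆ π∈)))) , to-hit b₂ (hit₂ (Π₃⊆ (Π₄⊆ π∈)))
                     , to-hit b₃ (hit₃ (Π₄⊆ π∈)) , to-hit b₄ (hit₄ π∈)))
             (≤-trans ratio (*-monoˡ-≤ (card X₀) (²-mono-≤ swapped)))
        where
        swapped : card (B ⊕ A) ≤ s
        swapped = card-mono (B ⊕ A) (A ⊕ B) λ p → swap (∈-⊕⁻ B A p)
          where
          swap : ∀ {z} → (∃₂ λ b a → b ∈ˢ B × a ∈ˢ A × z ≡ b ⊹ a) → z ∈ˢ (A ⊕ B)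
          swap (b , a , b∈ , a∈ , refl) = subst (_∈ˢ (A ⊕ B)) (⊹-comm a b) (∈-⊕⁺ A B a∈ b∈)

    -- `A′` supplies the sets `Y_b`, whose sums with `B + B` must be few. The witnesses of hits are
    -- regarded as elements of `A`, because `X₀ + A + A` is controlled by `|A + B|`.
    sum-product-nonzero : ∀ e M c (A B V : FinSet F) → 0 < card A → 0 < card B → (∀ {b} → b ∈ˢ B → b ≢ 0#) →
      card B ² ≤ e * card univ → (∀ {a b} → a ∈ˢ A → b ∈ˢ B → a · b ∈ˢ V) →
      card (A ⊕ B) ≤ M → card V ≤ M → card A ≤ c * card B →
      card A ^ 15 ≤ 2 ² ² ² * (c * c ² ²) * (8 ² * 4 ² * suc e) * M ^ 14
    sum-product-nonzero e M c A B V 0<A 0<B nz small into s≤M V≤M a≤cm =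
      let A′ , A′⊆A , a≤2n , double = large-subset-small-double-sumset A B
          b̂ , b̂∈ = card-pos⁻ B 0<B
          b₀ , b₀∈ , pop = popular-base A′ B V b̂∈ nz (λ a∈ b∈ → into (A′⊆A a∈) b∈)
          G = ∑ B λ b → card (common A′ b b₀)
          t , 0<t , G²≤ = heavy-level B (λ b → card (common A′ b b₀)) (card A′) 0<B
            (λ {b} _ → card-mono (common A′ b b₀) A′ λ p → proj₁ (∈-select⁻ (related? A′ b b₀) A′ p))
          X = level B (λ b → card (common A′ b b₀)) t
          levels = energy-level 8 (card A′) (card B) (card V) G t (card X) 0<B pop G²≤
          -- The level set cannot be empty, since `levels` bounds the positive number `|A′|⁴ |B|` by
          -- a multiple of `|X|`.
          x̂ , x̂∈ = card-pos⁻ X (nonempty (card A′) (card B) (card X) (8 * card V ²) (t ²)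
            (half-pos (card A) (card A′) 0<A a≤2n) 0<B levels)
          X⊆B = λ {b} → X⊆ (λ b → card (common A′ b b₀)) t {b}
          P = pivot X {e} x̂∈ (≤-trans (²-mono-≤ (card-mono X B X⊆B)) small)
          π₄ , steps , sums = dilated-sums {t = t} A A′ B X A′⊆A X⊆B (nz b₀∈)
            (λ {b} p → proj₂ (∈-select⁻ (λ b → t ≤? card (common A′ b b₀)) B p)) P
      in to-powers c 2 (8 ² * 4 ² * suc e) (card A) (card A′) (card B) (card V) (card (A ⊕ B)) M a≤2n a≤cm V≤M s≤M
           (assemble 8 4 (suc e) (card A) (card A′) (card B) (card V) t (card X) (card (Pivot.Π P)) π₄
             (card (A ⊕ B)) (card ((A′ ⊕ B) ⊕ B)) levels sums
             (cancel-a (card ((A′ ⊕ B) ⊕ B)) (card A) (card A′) (card (A ⊕ B)) 0<A (card-mono A′ A A′⊆A) double)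
             steps (Pivot.large P))
      where
      half-pos : ∀ a n → 0 < a → a ≤ 2 * n → 0 < n
      half-pos a zero 0<a a≤ = contradiction (≤-trans 0<a a≤) λ ()
      half-pos a (suc n) _ _ = s≤s z≤n
      nonempty : ∀ n m x k t → 0 < n → 0 < m → n ² ² * m ≤ k * (t * x) → 0 < x
      nonempty n m (suc x) k t _ _ _ = s≤s z≤n
      nonempty n m zero k t 0<n 0<m le = contradiction
        (≤-trans (*-mono-≤ {1} {n ² ²} {1} (*-mono-≤ {1} {n ²} {1} (*-mono-≤ 0<n 0<n) (*-mono-≤ 0<n 0<n)) 0<m)
          (≤-trans le (≤-reflexive (trans (cong (k *_) (*-zeroʳ t)) (*-zeroʳ k))))) λ ()
      X⊆ : (f : F → ℕ) (t : ℕ) → level B f t ⊆ˢ B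
      X⊆ f t p = proj₁ (∈-select⁻ (λ b → t ≤? f b) B p)
      cancel-a : ∀ w a n s → 0 < a → n ≤ a → w * (a * a) ≤ 4 * (s * s) * n → w * a ≤ 4 * s ²
      cancel-a w a n s 0<a n≤a le = *-cancelʳ-≤ _ _ a {{>-nonZero 0<a}} (begin
        w * a * a          ≡⟨ *-assoc w a a ⟩
        w * (a * a)        ≤⟨ le ⟩
        4 * (s * s) * n    ≤⟨ *-monoʳ-≤ (4 * (s * s)) n≤a ⟩
        4 * (s * s) * a    ∎)
        where open ≤-Reasoning

  nonzero? : Decidable (λ b → b ≢ 0#)
  nonzero? b = ¬? (b ≟ 0#)

  card-nonzero : (B : FinSet F) → card B ≤ 1 + card (select nonzero? B)
  card-nonzero B = ≤-trans (≤-reflexive (card-select-split (_≟ 0#) B)) (+-monoˡ-≤ (card (select nonzero? B))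
    (card-mono (select (_≟ 0#) B) (mkFinSet (0# ∷ []) ([] ∷ [])) λ p → here (proj₂ (∈-select⁻ (_≟ 0#) B p))))

  -- Zero is discarded from B; the constants change only by a factor 2 unless B has at most one element.
  sum-product : ∀ c M (A B V : FinSet F) → 0 < card A → 0 < card B →
    card A ≤ c * card B → card B ≤ c * card A → card A ² ≤ c ² * card univ →
    (∀ {a b} → a ∈ˢ A → b ∈ˢ B → a · b ∈ˢ V) → card (A ⊕ B) ≤ M → card V ≤ M →
    card A ^ 15 ≤ growth c * M ^ 14
  sum-product c M A B V 0<A 0<B a≤cb b≤ca a²≤c²p into s≤M V≤M =
    split (card (select nonzero? B)) refl
    where
    open ≤-Reasoning
    a b p K : ℕ
    a = card A
    b = card B
    p = card univ
    K = 2 ² ² ² * ((2 * c) * (2 * c) ² ²) * (8 ² * 4 ² * suc (c ² ²))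
    B* : FinSet F
    B* = select nonzero? B
    B*⊆B : B* ⊆ˢ B
    B*⊆B p = proj₁ (∈-select⁻ nonzero? B p)
    -- The bound on `|A|` passes to `B` at the cost of another `c²`; this is the `c⁴` inside
    -- `growth`.
    small : card B* ² ≤ c ² ² * p
    small = begin
      card B* ²            ≤⟨ ²-mono-≤ (card-mono B* B B*⊆B) ⟩
      b ²                  ≤⟨ ²-mono-≤ b≤ca ⟩
      (c * a) ²            ≡⟨ ²-* c a ⟩
      c ² * a ²            ≤⟨ *-monoʳ-≤ (c ²) a²≤c²p ⟩
      c ² * (c ² * p)      ≡⟨ *-assoc (c ²) (c ²) p ⟨
      c ² ² * p            ∎
    split : ∀ k → card B* ≡ k → a ^ 15 ≤ growth c * M ^ 14
    -- Now `B` is contained in `{0}`, so `|A| ≤ c`, and `M ≥ 1` lets the summand `c ^ 15` finish.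
    split zero b*≡0 = begin
      a ^ 15            ≤⟨ ^-monoˡ-≤ 15 a≤c ⟩
      c ^ 15            ≡⟨ *-identityʳ (c ^ 15) ⟨
      c ^ 15 * 1        ≤⟨ *-mono-≤ (m≤n+m (c ^ 15) K) (m^n>0 M {{>-nonZero 0<M}} 14) ⟩
      growth c * M ^ 14 ∎
      where
      a≤c : a ≤ c
      a≤c = begin
        a                   ≤⟨ a≤cb ⟩
        c * b               ≤⟨ *-monoʳ-≤ c (≤-trans (card-nonzero B) (≤-reflexive (cong suc b*≡0))) ⟩
        c * 1               ≡⟨ *-identityʳ c ⟩
        c                   ∎
      0<M : 0 < M
      0<M = ≤-trans 0<A (≤-trans (card-≤-⊕ A B (proj₂ (card-pos⁻ B 0<B))) s≤M)
    split (suc k) b*≡ = begin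
      a ^ 15                ≤⟨ sum-product-nonzero (c ² ²) M (2 * c) A B* V 0<A 0<B*
                                 (λ q → proj₂ (∈-select⁻ nonzero? B q)) small (λ a∈ b∈ → into a∈ (B*⊆B b∈))
                                 (≤-trans (card-mono (A ⊕ B*) (A ⊕ B) (⊕-mono A A B* B (λ q → q) B*⊆B)) s≤M) V≤M a≤2cb* ⟩
      K * M ^ 14            ≤⟨ *-monoˡ-≤ (M ^ 14) (m≤m+n K (c ^ 15)) ⟩
      growth c * M ^ 14     ∎
      where
      0<B* : 0 < card B*
      0<B* = subst (0 <_) (sym b*≡) (s≤s z≤n)
      a≤2cb* : a ≤ 2 * c * card B*
      a≤2cb* = begin
        a                          ≤⟨ a≤cb ⟩
        c * b                      ≤⟨ *-monoʳ-≤ c (≤-trans (card-nonzero B) (+-monoˡ-≤ (card B*) 0<B*)) ⟩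
        c * (card B* + card B*)    ≡⟨ solve 2 (λ c m → c :* (m :+ m) := con 2 :* c :* m) refl c (card B*) ⟩
        2 * c * card B*            ∎

-- Residues modulo a prime as a finite domain

module Residues where

  open import Data.Nat using (ℕ; zero; suc; _+_; _*_; _∸_; _≤_; _<_; NonZero; s≤s; z≤n)
  open import Data.Nat.Properties using (+-comm; +-assoc; *-comm; *-assoc; *-distribʳ-+; *-identityˡ; +-identityʳ;
    m+[n∸m]≡n; m∸n≤m; ≤-trans; ≤-<-trans; <⇒≤; <-cmp; ≤-total; m>n⇒m∸n≢0)
  open import Data.Nat.DivMod using (_%_; _mod_; m%n<n; m<n⇒m%n≡m; %-distribˡ-+; %-distribˡ-*; [m+n]%n≡m%n)
  open import Data.Nat.Divisibility using (_∣_; >⇒∤; m%n≡0⇒n∣m)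
  open import Data.Nat.Primality using (Prime; euclidsLemma)
  open import Data.Nat.Solver using (module +-*-Solver)
  open +-*-Solver using (solve; _:=_; _:+_; _:*_)
  open import Data.Fin using (Fin; toℕ)
  open import Data.Fin.Properties using (toℕ-fromℕ<; toℕ-injective; toℕ<n; _≟_)
  open import Data.List using (allFin)
  open import Data.List.Membership.Propositional.Properties using (∈-allFin)
  import Data.List.Relation.Unary.Unique.Propositional.Properties as Unique
  open import Data.Product using (_,_)
  open import Data.Sum using (inj₁; inj₂)
  open import Algebra.Structures using (IsCommutativeSemiring)
  open import Algebra.Structures.Biased using (isCommutativeSemiringˡ)
  open import Relation.Nullary using (contradiction)
  open import Relation.Binary.Definitions using (tri<; tri≈; tri>)
  open import Relation.Binary.PropositionalEquality

  module _ (p : ℕ) .{{_ : NonZero p}} where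

    toℕ-mod : ∀ m → toℕ (m mod p) ≡ m % p
    toℕ-mod m = toℕ-fromℕ< (m%n<n m p)

    mod-cong : ∀ {m n} → m % p ≡ n % p → m mod p ≡ n mod p
    mod-cong {m} {n} e = toℕ-injective (trans (toℕ-mod m) (trans e (sym (toℕ-mod n))))

    mod-reflect : ∀ {m n} → m mod p ≡ n mod p → m % p ≡ n % p
    mod-reflect {m} {n} e = trans (sym (toℕ-mod m)) (trans (cong toℕ e) (toℕ-mod n))

    toℕ-% : ∀ (x : Fin p) → toℕ x % p ≡ toℕ x
    toℕ-% x = m<n⇒m%n≡m (toℕ<n x)

    mod-toℕ : ∀ (x : Fin p) → toℕ x mod p ≡ x
    mod-toℕ x = toℕ-injective (trans (toℕ-mod (toℕ x)) (toℕ-% x))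

    +-mod : ∀ m n → (m mod p) +ₚ (n mod p) ≡ (m + n) mod p
    +-mod m n = mod-cong (trans (cong₂ (λ u v → (u + v) % p) (toℕ-mod m) (toℕ-mod n)) (sym (%-distribˡ-+ m n p)))

    *-mod : ∀ m n → (m mod p) *ₚ (n mod p) ≡ (m * n) mod p
    *-mod m n = mod-cong (trans (cong₂ (λ u v → (u * v) % p) (toℕ-mod m) (toℕ-mod n)) (sym (%-distribˡ-* m n p)))

    +ₚ-assoc : ∀ (x y z : Fin p) → (x +ₚ y) +ₚ z ≡ x +ₚ (y +ₚ z)
    +ₚ-assoc x y z = begin
      (x +ₚ y) +ₚ z                        ≡⟨ cong ((x +ₚ y) +ₚ_) (mod-toℕ z) ⟨
      (x +ₚ y) +ₚ (toℕ z mod p)            ≡⟨ +-mod (toℕ x + toℕ y) (toℕ z) ⟩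
      (toℕ x + toℕ y + toℕ z) mod p        ≡⟨ cong (_mod p) (+-assoc (toℕ x) (toℕ y) (toℕ z)) ⟩
      (toℕ x + (toℕ y + toℕ z)) mod p      ≡⟨ +-mod (toℕ x) (toℕ y + toℕ z) ⟨
      (toℕ x mod p) +ₚ (y +ₚ z)            ≡⟨ cong (_+ₚ (y +ₚ z)) (mod-toℕ x) ⟩
      x +ₚ (y +ₚ z)                        ∎
      where open ≡-Reasoning

    *ₚ-assoc : ∀ (x y z : Fin p) → (x *ₚ y) *ₚ z ≡ x *ₚ (y *ₚ z)
    *ₚ-assoc x y z = begin
      (x *ₚ y) *ₚ z                        ≡⟨ cong ((x *ₚ y) *ₚ_) (mod-toℕ z) ⟨
      (x *ₚ y) *ₚ (toℕ z mod p)            ≡⟨ *-mod (toℕ x * toℕ y) (toℕ z) ⟩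
      (toℕ x * toℕ y * toℕ z) mod p        ≡⟨ cong (_mod p) (*-assoc (toℕ x) (toℕ y) (toℕ z)) ⟩
      (toℕ x * (toℕ y * toℕ z)) mod p      ≡⟨ *-mod (toℕ x) (toℕ y * toℕ z) ⟨
      (toℕ x mod p) *ₚ (y *ₚ z)            ≡⟨ cong (_*ₚ (y *ₚ z)) (mod-toℕ x) ⟩
      x *ₚ (y *ₚ z)                        ∎
      where open ≡-Reasoning

    +ₚ-comm : ∀ (x y : Fin p) → x +ₚ y ≡ y +ₚ x
    +ₚ-comm x y = cong (_mod p) (+-comm (toℕ x) (toℕ y))

    *ₚ-comm : ∀ (x y : Fin p) → x *ₚ y ≡ y *ₚ x
    *ₚ-comm x y = cong (_mod p) (*-comm (toℕ x) (toℕ y))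

    +ₚ-identityˡ : ∀ (x : Fin p) → (0 mod p) +ₚ x ≡ x
    +ₚ-identityˡ x = begin
      (0 mod p) +ₚ x             ≡⟨ cong ((0 mod p) +ₚ_) (mod-toℕ x) ⟨
      (0 mod p) +ₚ (toℕ x mod p) ≡⟨ +-mod 0 (toℕ x) ⟩
      toℕ x mod p                ≡⟨ mod-toℕ x ⟩
      x                          ∎
      where open ≡-Reasoning

    *ₚ-identityˡ : ∀ (x : Fin p) → (1 mod p) *ₚ x ≡ x
    *ₚ-identityˡ x = begin
      (1 mod p) *ₚ x             ≡⟨ cong ((1 mod p) *ₚ_) (mod-toℕ x) ⟨
      (1 mod p) *ₚ (toℕ x mod p) ≡⟨ *-mod 1 (toℕ x) ⟩
      (1 * toℕ x) mod p          ≡⟨ cong (_mod p) (*-identityˡ (toℕ x)) ⟩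
      toℕ x mod p                ≡⟨ mod-toℕ x ⟩
      x                          ∎
      where open ≡-Reasoning

    *ₚ-zeroˡ : ∀ (x : Fin p) → (0 mod p) *ₚ x ≡ 0 mod p
    *ₚ-zeroˡ x = trans (cong ((0 mod p) *ₚ_) (sym (mod-toℕ x))) (*-mod 0 (toℕ x))

    *ₚ-distribʳ : ∀ (x y z : Fin p) → (y +ₚ z) *ₚ x ≡ (y *ₚ x) +ₚ (z *ₚ x)
    *ₚ-distribʳ x y z = begin
      (y +ₚ z) *ₚ x                               ≡⟨ cong ((y +ₚ z) *ₚ_) (mod-toℕ x) ⟨
      (y +ₚ z) *ₚ (toℕ x mod p)                   ≡⟨ *-mod (toℕ y + toℕ z) (toℕ x) ⟩
      ((toℕ y + toℕ z) * toℕ x) mod p             ≡⟨ cong (_mod p) (*-distribʳ-+ (toℕ x) (toℕ y) (toℕ z)) ⟩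
      (toℕ y * toℕ x + toℕ z * toℕ x) mod p       ≡⟨ +-mod (toℕ y * toℕ x) (toℕ z * toℕ x) ⟨
      (y *ₚ x) +ₚ (z *ₚ x)                        ∎
      where open ≡-Reasoning

    isCommutativeSemiring : IsCommutativeSemiring _≡_ (_+ₚ_ {p}) _*ₚ_ (0 mod p) (1 mod p)
    isCommutativeSemiring = isCommutativeSemiringˡ record
      { +-isCommutativeMonoid = record
        { isMonoid = record
          { isSemigroup = record
            { isMagma = record { isEquivalence = isEquivalence ; ∙-cong = cong₂ _+ₚ_ }
            ; assoc = +ₚ-assoc }
          ; identity = +ₚ-identityˡ , λ x → trans (+ₚ-comm x (0 mod p)) (+ₚ-identityˡ x) }
        ; comm = +ₚ-comm }
      ; *-isCommutativeMonoid = record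
        { isMonoid = record
          { isSemigroup = record
            { isMagma = record { isEquivalence = isEquivalence ; ∙-cong = cong₂ _*ₚ_ }
            ; assoc = *ₚ-assoc }
          ; identity = *ₚ-identityˡ , λ x → trans (*ₚ-comm x (1 mod p)) (*ₚ-identityˡ x) }
        ; comm = *ₚ-comm }
      ; distribʳ = *ₚ-distribʳ
      ; zeroˡ = *ₚ-zeroˡ
      }

    +ₚ-cancelʳ : ∀ (z : Fin p) {x y} → x +ₚ z ≡ y +ₚ z → x ≡ y
    +ₚ-cancelʳ z {x} {y} e = trans (sym (undo x)) (trans (cong (_+ₚ z⁻) e) (undo y))
      where
      z⁻ : Fin p
      z⁻ = (p ∸ toℕ z) mod p
      undo : ∀ x → (x +ₚ z) +ₚ z⁻ ≡ x
      undo x = begin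
        (x +ₚ z) +ₚ z⁻                         ≡⟨ +-mod (toℕ x + toℕ z) (p ∸ toℕ z) ⟩
        (toℕ x + toℕ z + (p ∸ toℕ z)) mod p    ≡⟨ cong (_mod p) (trans (+-assoc (toℕ x) _ _)
                                                    (cong (toℕ x +_) (m+[n∸m]≡n (<⇒≤ (toℕ<n z))))) ⟩
        (toℕ x + p) mod p                      ≡⟨ mod-cong ([m+n]%n≡m%n (toℕ x) p) ⟩
        toℕ x mod p                            ≡⟨ mod-toℕ x ⟩
        x                                      ∎
        where open ≡-Reasoning

    private
      less-than-p : ∀ {d} → d < p → p ∣ d → d ≡ 0
      less-than-p {zero}  _   _   = refl
      less-than-p {suc d} d<p p∣d = contradiction p∣d (>⇒∤ d<p)

      -- The order hypotheses make the truncated differences of representatives exact, so the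
      -- product expands over the naturals and the mixed terms cancel modulo `p`.
      difference-divides : ∀ (x y z w : Fin p) → toℕ y < toℕ x → toℕ w ≤ toℕ z →
        (x *ₚ z) +ₚ (y *ₚ w) ≡ (x *ₚ w) +ₚ (y *ₚ z) → p ∣ (toℕ x ∸ toℕ y) * (toℕ z ∸ toℕ w)
      difference-divides x y z w y<x w≤z e = m%n≡0⇒n∣m (d * k) p
        (trans (mod-reflect (+ₚ-cancelʳ (common mod p) {(d * k) mod p} {0 mod p} (begin
          ((d * k) mod p) +ₚ (common mod p)      ≡⟨ +-mod (d * k) common ⟩
          (d * k + common) mod p                 ≡⟨ cong (_mod p) expand ⟨
          (toℕ x * toℕ z + toℕ y * toℕ w) mod p  ≡⟨ +-mod (toℕ x * toℕ z) (toℕ y * toℕ w) ⟨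
          (x *ₚ z) +ₚ (y *ₚ w)                   ≡⟨ e ⟩
          (x *ₚ w) +ₚ (y *ₚ z)                   ≡⟨ +-mod (toℕ x * toℕ w) (toℕ y * toℕ z) ⟩
          common mod p                           ≡⟨ +-mod 0 common ⟨
          (0 mod p) +ₚ (common mod p)            ∎)))
          (m<n⇒m%n≡m (≤-trans (s≤s z≤n) (toℕ<n x))))
        where
        open ≡-Reasoning
        d k common : ℕ
        d = toℕ x ∸ toℕ y
        k = toℕ z ∸ toℕ w
        common = toℕ x * toℕ w + toℕ y * toℕ z
        expand : toℕ x * toℕ z + toℕ y * toℕ w ≡ d * k + common
        expand = subst₂ (λ X Z → X * Z + toℕ y * toℕ w ≡ d * k + (X * toℕ w + toℕ y * Z))
          (m+[n∸m]≡n (<⇒≤ y<x)) (m+[n∸m]≡n w≤z)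
          (solve 4 (λ y w d k → (y :+ d) :* (w :+ k) :+ y :* w := d :* k :+ ((y :+ d) :* w :+ y :* (w :+ k)))
            refl (toℕ y) (toℕ w) d k)

    module _ (isPrime : Prime p) where

      private
        cross-cancel-ordered : ∀ (x y z w : Fin p) → toℕ y < toℕ x → toℕ w ≤ toℕ z →
          (x *ₚ z) +ₚ (y *ₚ w) ≡ (x *ₚ w) +ₚ (y *ₚ z) → z ≡ w
        cross-cancel-ordered x y z w y<x w≤z e
          with euclidsLemma (toℕ x ∸ toℕ y) (toℕ z ∸ toℕ w) isPrime (difference-divides x y z w y<x w≤z e)
        ... | inj₁ p∣d = contradiction (less-than-p (≤-<-trans (m∸n≤m (toℕ x) (toℕ y)) (toℕ<n x)) p∣d)
                (m>n⇒m∸n≢0 y<x)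
        ... | inj₂ p∣k = toℕ-injective (begin
            toℕ z                        ≡⟨ m+[n∸m]≡n w≤z ⟨
            toℕ w + (toℕ z ∸ toℕ w)      ≡⟨ cong (toℕ w +_) (less-than-p (≤-<-trans (m∸n≤m (toℕ z) (toℕ w)) (toℕ<n z)) p∣k) ⟩
            toℕ w + 0                    ≡⟨ +-identityʳ (toℕ w) ⟩
            toℕ w                        ∎)
            where open ≡-Reasoning

        cross-cancel-> : ∀ (x y z w : Fin p) → toℕ y < toℕ x →
          (x *ₚ z) +ₚ (y *ₚ w) ≡ (x *ₚ w) +ₚ (y *ₚ z) → z ≡ w
        cross-cancel-> x y z w y<x e with ≤-total (toℕ w) (toℕ z)
        ... | inj₁ w≤z = cross-cancel-ordered x y z w y<x w≤z e
        ... | inj₂ z≤w = sym (cross-cancel-ordered x y w z y<x z≤w (sym e))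

      -- The equation is symmetric under exchanging `x` with `y` or `z` with `w`, which reduces it
      -- to ordered representatives. Euclid's lemma then makes one difference a multiple of `p`;
      -- being below `p`, it vanishes.
      cross-cancel : ∀ {x y z w : Fin p} → x ≢ y → (x *ₚ z) +ₚ (y *ₚ w) ≡ (x *ₚ w) +ₚ (y *ₚ z) → z ≡ w
      cross-cancel {x} {y} {z} {w} x≢y e with <-cmp (toℕ x) (toℕ y)
      ... | tri< x<y _ _ = cross-cancel-> y x z w x<y
              (trans (+ₚ-comm (y *ₚ z) (x *ₚ w)) (trans (sym e) (+ₚ-comm (x *ₚ z) (y *ₚ w))))
      ... | tri≈ _ x≡y _ = contradiction (toℕ-injective x≡y) x≢y
      ... | tri> _ _ y<x = cross-cancel-> x y z w y<x e

      1-generates : (P : Fin p → Set) → P (0 mod p) → (∀ x → P x → P (x +ₚ (1 mod p))) → ∀ x → P x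
      1-generates P P0 Psuc x = subst P (mod-toℕ x) (go (toℕ x))
        where
        go : ∀ n → P (n mod p)
        go zero = P0
        go (suc n) = subst P (trans (+-mod n 1) (cong (_mod p) (+-comm n 1))) (Psuc (n mod p) (go n))

      𝔽 : FiniteDomain
      𝔽 = record
        { F = Fin p ; _≟_ = _≟_ ; _⊹_ = _+ₚ_ ; _·_ = _*ₚ_ ; 0# = 0 mod p ; 1# = 1 mod p
        ; isCommutativeSemiring = isCommutativeSemiring
        ; ⊹-cancelʳ = +ₚ-cancelʳ
        ; cross-cancel = cross-cancel
        ; univ = mkFinSet (allFin p) (Unique.allFin⁺ p)
        ; complete = ∈-allFin
        ; 1#-generates = 1-generates
        }

-- From characteristic vectors to lists

module Subsets where

  open import Data.Bool using (true; false)
  open import Data.Nat using (ℕ; zero; suc; NonZero; _<_)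
  open import Data.Fin using (Fin; zero; suc)
  open import Data.Fin.Properties using (suc-injective)
  open import Data.Fin.Subset using (Subset; _∈_; ∣_∣; Nonempty)
  open import Data.Vec using ([]; _∷_; here; there)
  open import Data.Vec.Properties using (lookup∘tabulate; lookup⇒[]=)
  open import Data.List as List using ([]; _∷_)
  open import Data.List.Properties using (length-map)
  open import Data.List.Membership.Propositional using () renaming (_∈_ to _∈ᴸ_)
  open import Data.List.Membership.Propositional.Properties using (∈-map⁺; ∈-map⁻)
  import Data.List.Relation.Unary.Any as Any
  import Data.List.Relation.Unary.All as All
  open import Data.List.Relation.Unary.AllPairs using ([]; _∷_)
  import Data.List.Relation.Unary.Unique.Propositional.Properties as Unique
  open import Data.Product using (_,_)
  open import Relation.Nullary.Decidable using (isYes≗does; dec-true; ⌊_⌋; Dec)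
  open import Relation.Binary.PropositionalEquality

  members : ∀ {n} → Subset n → FinSet (Fin n)
  members [] = mkFinSet [] []
  members (false ∷ A) = mkFinSet (List.map suc (elems (members A))) (Unique.map⁺ suc-injective (unique (members A)))
  members (true ∷ A) = mkFinSet (zero ∷ List.map suc (elems (members A)))
    (All.tabulate fresh ∷ Unique.map⁺ suc-injective (unique (members A)))
    where
    fresh : ∀ {x} → x ∈ᴸ List.map suc (elems (members A)) → zero ≢ x
    fresh p refl with ∈-map⁻ suc p
    ... | _ , _ , ()

  card-members : ∀ {n} (A : Subset n) → card (members A) ≡ ∣ A ∣
  card-members [] = refl
  card-members (false ∷ A) = trans (length-map suc (elems (members A))) (card-members A)
  card-members (true ∷ A) = cong suc (trans (length-map suc (elems (members A))) (card-members A))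

  ∈-members⁺ : ∀ {n} (A : Subset n) {x} → x ∈ A → x ∈ˢ members A
  ∈-members⁺ (true ∷ A)  here      = Any.here refl
  ∈-members⁺ (true ∷ A)  (there p) = Any.there (∈-map⁺ suc (∈-members⁺ A p))
  ∈-members⁺ (false ∷ A) (there p) = ∈-map⁺ suc (∈-members⁺ A p)

  ∈-members⁻ : ∀ {n} (A : Subset n) {x} → x ∈ˢ members A → x ∈ A
  ∈-members⁻ (true ∷ A) (Any.here refl) = here
  ∈-members⁻ (true ∷ A) (Any.there p) with ∈-map⁻ suc p
  ... | _ , q , refl = there (∈-members⁻ A q)
  ∈-members⁻ (false ∷ A) p with ∈-map⁻ suc p
  ... | _ , q , refl = there (∈-members⁻ A q)

  nonempty-members : ∀ {n} (A : Subset n) → Nonempty A → 0 < card (members A)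
  nonempty-members A (x , x∈A) = card-pos⁺ (members A) (∈-members⁺ A x∈A)

  module _ {p : ℕ} .{{_ : NonZero p}} (A B : Subset p) where

    private
      decided : {P : Set} (d : Dec P) → P → ⌊ d ⌋ ≡ true
      decided d x = trans (isYes≗does d) (dec-true d x)

    ∈-sumset : ∀ {a b} → a ∈ A → b ∈ B → a +ₚ b ∈ sumset A B
    ∈-sumset {a} {b} a∈A b∈B = lookup⇒[]= (a +ₚ b) (sumset A B)
      (trans (lookup∘tabulate _ (a +ₚ b)) (decided _ (a , b , a∈A , b∈B , refl)))

    ∈-prodset : ∀ {a b} → a ∈ A → b ∈ B → a *ₚ b ∈ prodset A B
    ∈-prodset {a} {b} a∈A b∈B = lookup⇒[]= (a *ₚ b) (prodset A B)
      (trans (lookup∘tabulate _ (a *ₚ b)) (decided _ (a , b , a∈A , b∈B , refl)))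

-- From rational constants to natural numbers

module Rationals where

  open import Data.Nat as ℕ using (ℕ; suc; z≤n; s≤s)
  import Data.Nat.Properties as ℕ
  open import Data.Integer as ℤ using (ℤ; +_; -[1+_])
  import Data.Integer.Properties as ℤ
  open import Data.Rational
  open import Data.Rational.Properties
  open import Data.Rational.Unnormalised as ℚᵘ using (ℚᵘ; mkℚᵘ; *≡*; *≤*)
  import Data.Rational.Unnormalised.Properties as ℚᵘ
  open import Relation.Binary.PropositionalEquality
  open Arithmetic using (_²)

  -- The quotient `(+ n) / 1` is normalised by a gcd that does not compute for a variable `n`; the
  -- unnormalised form has its denominator 1 in plain sight.
  toℚᵘ-ℕ→ℚ : ∀ n → toℚᵘ (ℕ→ℚ n) ℚᵘ.≃ mkℚᵘ (+ n) 0
  toℚᵘ-ℕ→ℚ n = toℚᵘ-fromℚᵘ (mkℚᵘ (+ n) 0)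

  ℕ→ℚ-mono-≤ : ∀ {m n} → m ℕ.≤ n → ℕ→ℚ m ≤ ℕ→ℚ n
  ℕ→ℚ-mono-≤ {m} {n} m≤n = toℚᵘ-cancel-≤ (begin
    toℚᵘ (ℕ→ℚ m)    ≃⟨ toℚᵘ-ℕ→ℚ m ⟩
    mkℚᵘ (+ m) 0    ≤⟨ *≤* (ℤ.*-monoʳ-≤-nonNeg (+ 1) (ℤ.+≤+ m≤n)) ⟩
    mkℚᵘ (+ n) 0    ≃⟨ toℚᵘ-ℕ→ℚ n ⟨
    toℚᵘ (ℕ→ℚ n)    ∎)
    where open ℚᵘ.≤-Reasoning

  ℕ→ℚ-cancel-≤ : ∀ {m n} → ℕ→ℚ m ≤ ℕ→ℚ n → m ℕ.≤ n
  ℕ→ℚ-cancel-≤ {m} {n} le = ℤ.drop‿+≤+ (subst₂ ℤ._≤_ (ℤ.*-identityʳ (+ m)) (ℤ.*-identityʳ (+ n)) (ℚᵘ.drop-*≤* (begin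
    mkℚᵘ (+ m) 0    ≃⟨ toℚᵘ-ℕ→ℚ m ⟨
    toℚᵘ (ℕ→ℚ m)    ≤⟨ toℚᵘ-mono-≤ le ⟩
    toℚᵘ (ℕ→ℚ n)    ≃⟨ toℚᵘ-ℕ→ℚ n ⟩
    mkℚᵘ (+ n) 0    ∎)))
    where open ℚᵘ.≤-Reasoning

  ℕ→ℚ-* : ∀ m n → ℕ→ℚ (m ℕ.* n) ≡ ℕ→ℚ m * ℕ→ℚ n
  ℕ→ℚ-* m n = toℚᵘ-injective (begin
    toℚᵘ (ℕ→ℚ (m ℕ.* n))                 ≈⟨ toℚᵘ-ℕ→ℚ (m ℕ.* n) ⟩
    mkℚᵘ (+ (m ℕ.* n)) 0                 ≈⟨ *≡* (cong (ℤ._* (+ 1)) (ℤ.pos-* m n)) ⟩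
    mkℚᵘ (+ m) 0 ℚᵘ.* mkℚᵘ (+ n) 0       ≈⟨ ℚᵘ.*-cong (toℚᵘ-ℕ→ℚ m) (toℚᵘ-ℕ→ℚ n) ⟨
    toℚᵘ (ℕ→ℚ m) ℚᵘ.* toℚᵘ (ℕ→ℚ n)       ≈⟨ toℚᵘ-homo-* (ℕ→ℚ m) (ℕ→ℚ n) ⟨
    toℚᵘ (ℕ→ℚ m * ℕ→ℚ n)                 ∎)
    where open import Relation.Binary.Reasoning.Setoid ℚᵘ.≃-setoid

  ℕ→ℚ-^ : ∀ m k → ℕ→ℚ (m ℕ.^ k) ≡ ℕ→ℚ m ^ℚ k
  ℕ→ℚ-^ m 0       = refl
  ℕ→ℚ-^ m (suc k) = trans (ℕ→ℚ-* m (m ℕ.^ k)) (cong (ℕ→ℚ m *_) (ℕ→ℚ-^ m k))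

  ℕ→ℚ-nonNeg : ∀ n → NonNegative (ℕ→ℚ n)
  ℕ→ℚ-nonNeg n = normalize-nonNeg n 1

  -- A crude integer majorant of `c`: dropping a denominator of at least 1 only increases the
  -- absolute value.
  natural-bound : ℚ → ℕ
  natural-bound c = ℤ.∣ ↥ c ∣

  ≤-natural-bound : ∀ c → c ≤ ℕ→ℚ (natural-bound c)
  ≤-natural-bound c@record{} = toℚᵘ-cancel-≤ (begin
    toℚᵘ c                                    ≤⟨ *≤* (ℤ.≤-trans (ℤ.*-monoʳ-≤-nonNeg (+ 1) (i≤∣i∣ (↥ c))) enlarge) ⟩
    mkℚᵘ (+ natural-bound c) 0                ≃⟨ toℚᵘ-ℕ→ℚ (natural-bound c) ⟨
    toℚᵘ (ℕ→ℚ (natural-bound c))              ∎)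
    where
    open ℚᵘ.≤-Reasoning
    i≤∣i∣ : ∀ i → i ℤ.≤ + ℤ.∣ i ∣
    i≤∣i∣ (+ n)      = ℤ.≤-refl
    i≤∣i∣ (-[1+ n ]) = ℤ.-≤+
    enlarge : + natural-bound c ℤ.* + 1 ℤ.≤ + natural-bound c ℤ.* ↧ c
    enlarge = ℤ.*-monoˡ-≤-nonNeg (+ natural-bound c) (ℤ.+≤+ (s≤s z≤n))

  scale-bound : ∀ c {a b} → ℕ→ℚ a ≤ c * ℕ→ℚ b → a ℕ.≤ natural-bound c ℕ.* b
  scale-bound c {a} {b} le = ℕ→ℚ-cancel-≤ (begin
    ℕ→ℚ a                             ≤⟨ le ⟩
    c * ℕ→ℚ b                         ≤⟨ *-monoʳ-≤-nonNeg (ℕ→ℚ b) {{ℕ→ℚ-nonNeg b}} (≤-natural-bound c) ⟩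
    ℕ→ℚ (natural-bound c) * ℕ→ℚ b     ≡⟨ ℕ→ℚ-* (natural-bound c) b ⟨
    ℕ→ℚ (natural-bound c ℕ.* b)       ∎)
    where open ≤-Reasoning

  scale-bound² : ∀ c → 1ℚ ≤ c → ∀ {a b} → ℕ→ℚ (a ℕ.^ 2) ≤ (c ^ℚ 2) * ℕ→ℚ b → a ² ℕ.≤ natural-bound c ² ℕ.* b
  scale-bound² c 1≤c {a} {b} le = subst (ℕ._≤ ĉ ² ℕ.* b) (cong (a ℕ.*_) (ℕ.*-identityʳ a)) (ℕ→ℚ-cancel-≤ (begin
    ℕ→ℚ (a ℕ.^ 2)            ≤⟨ le ⟩
    (c ^ℚ 2) * ℕ→ℚ b         ≡⟨ cong (λ x → c * x * ℕ→ℚ b) (*-identityʳ c) ⟩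
    c * c * ℕ→ℚ b            ≤⟨ *-monoʳ-≤-nonNeg (ℕ→ℚ b) {{ℕ→ℚ-nonNeg b}} c²≤ĉ² ⟩
    ℕ→ℚ (ĉ ²) * ℕ→ℚ b        ≡⟨ ℕ→ℚ-* (ĉ ²) b ⟨
    ℕ→ℚ (ĉ ² ℕ.* b)          ∎))
    where
    open ≤-Reasoning
    ĉ : ℕ
    ĉ = natural-bound c
    c≥0 : NonNegative c
    -- Replacing the factors of `c * c` one at a time multiplies an inequality by `c`, which must
    -- not be negative.
    c≥0 = nonNegative (≤-trans (toℚᵘ-cancel-≤ (*≤* (ℤ.+≤+ z≤n))) 1≤c)
    c²≤ĉ² : c * c ≤ ℕ→ℚ (ĉ ²)
    c²≤ĉ² = begin
      c * c              ≤⟨ *-monoˡ-≤-nonNeg c {{c≥0}} (≤-natural-bound c) ⟩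
      c * ℕ→ℚ ĉ          ≤⟨ *-monoʳ-≤-nonNeg (ℕ→ℚ ĉ) {{ℕ→ℚ-nonNeg ĉ}} (≤-natural-bound c) ⟩
      ℕ→ℚ ĉ * ℕ→ℚ ĉ      ≡⟨ ℕ→ℚ-* ĉ ĉ ⟨
      ℕ→ℚ (ĉ ²)          ∎

  -- Instead of a root of `D`, the base `D + 1` is used: it is positive, and at least 1, so its
  -- powers dominate `D`.
  power-bound : ∀ D k {x y} → x ℕ.≤ D ℕ.* y → ℕ→ℚ x ≤ (ℕ→ℚ (suc D) ^ℚ suc k) * ℕ→ℚ y
  power-bound D k {x} {y} le = begin
    ℕ→ℚ x                                   ≤⟨ ℕ→ℚ-mono-≤ (ℕ.≤-trans le (ℕ.*-monoˡ-≤ y D≤)) ⟩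
    ℕ→ℚ (suc D ℕ.^ suc k ℕ.* y)             ≡⟨ ℕ→ℚ-* (suc D ℕ.^ suc k) y ⟩
    ℕ→ℚ (suc D ℕ.^ suc k) * ℕ→ℚ y           ≡⟨ cong (_* ℕ→ℚ y) (ℕ→ℚ-^ (suc D) (suc k)) ⟩
    (ℕ→ℚ (suc D) ^ℚ suc k) * ℕ→ℚ y          ∎
    where
    open ≤-Reasoning
    D≤ : D ℕ.≤ suc D ℕ.^ suc k
    D≤ = ℕ.≤-trans (ℕ.n≤1+n D) (ℕ.m≤m*n (suc D) (suc D ℕ.^ k) {{ℕ.m^n≢0 (suc D) k}})

  ℕ→ℚ-positive : ∀ n → 0ℚ < ℕ→ℚ (suc n)
  ℕ→ℚ-positive n = positive⁻¹ (ℕ→ℚ (suc n)) {{normalize-pos (suc n) 1}}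

-- The estimate over prime fields

module PrimeFields where

  open import Data.Nat using (ℕ; NonZero; _≤_; _*_; _^_; _⊔_)
  open import Data.Nat.Properties using (≤-trans; ≤-reflexive; m≤m⊔n; m≤n⊔m)
  open import Data.Nat.Primality using (Prime)
  open import Data.Fin.Subset using (Subset; ∣_∣; Nonempty)
  open import Data.List.Properties using (length-tabulate)
  open import Data.Product using (_,_)
  open import Relation.Binary.PropositionalEquality
  open Arithmetic using (_²)
  open Constants using (growth)
  open Subsets

  sum-product-𝔽ₚ : ∀ c p .{{_ : NonZero p}} → Prime p → (A B : Subset p) → Nonempty A → Nonempty B →
    ∣ A ∣ ≤ c * ∣ B ∣ → ∣ B ∣ ≤ c * ∣ A ∣ → ∣ A ∣ ² ≤ c ² * p →
    ∣ A ∣ ^ 15 ≤ growth c * (∣ sumset A B ∣ ⊔ ∣ prodset A B ∣) ^ 14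
  sum-product-𝔽ₚ c p isPrime A B A≢∅ B≢∅ a≤cb b≤ca a²≤c²p =
    subst (λ a → a ^ 15 ≤ growth c * M ^ 14) (card-members A)
      (sum-product c M Aˢ Bˢ Vˢ (nonempty-members A A≢∅) (nonempty-members B B≢∅)
        (subst₂ (λ a b → a ≤ c * b) (sym (card-members A)) (sym (card-members B)) a≤cb)
        (subst₂ (λ a b → b ≤ c * a) (sym (card-members A)) (sym (card-members B)) b≤ca)
        (subst₂ (λ a q → a ² ≤ c ² * q) (sym (card-members A)) (sym (length-tabulate {n = p} (λ i → i))) a²≤c²p)
        (λ a∈ b∈ → ∈-members⁺ (prodset A B) (∈-prodset A B (∈-members⁻ A a∈) (∈-members⁻ B b∈)))
        (≤-trans (card-mono (Aˢ ⊕ Bˢ) (members (sumset A B)) sums)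
          (≤-trans (≤-reflexive (card-members (sumset A B))) (m≤m⊔n ∣ sumset A B ∣ ∣ prodset A B ∣)))
        (≤-trans (≤-reflexive (card-members (prodset A B))) (m≤n⊔m ∣ sumset A B ∣ ∣ prodset A B ∣)))
    where
    D : FiniteDomain
    D = Residues.𝔽 p isPrime
    open SumProduct D using (_⊕_; ∈-⊕⁻; sum-product)
    M : ℕ
    M = ∣ sumset A B ∣ ⊔ ∣ prodset A B ∣
    Aˢ Bˢ Vˢ : FinSet (FiniteDomain.F D)
    Aˢ = members A
    Bˢ = members B
    Vˢ = members (prodset A B)
    sums : (Aˢ ⊕ Bˢ) ⊆ˢ members (sumset A B)
    sums z∈ with ∈-⊕⁻ Aˢ Bˢ z∈
    ... | a , b , a∈ , b∈ , refl = ∈-members⁺ (sumset A B) (∈-sumset A B (∈-members⁻ A a∈) (∈-members⁻ B b∈))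

open import Data.Nat as ℕ using (ℕ; NonZero; _⊔_; _^_)
open import Data.Nat.Primality using (Prime)
open import Data.Fin.Subset using (Subset; ∣_∣; Nonempty)
open import Data.Product using (Σ; _×_; _,_)
open import Data.Rational using (ℚ; _≤_; _<_; _*_; 0ℚ; 1ℚ)
open Rationals

-- Fractional exponents are cleared to stay within the rationals: the size condition is squared and
-- the conclusion raised to the power 14, which is why `C` carries that exponent.
theorem1p5 : (c : ℚ) → 1ℚ ≤ c →
    Σ ℚ λ C → 0ℚ < C ×
    ((p : ℕ) .{{_ : NonZero p}} → Prime p → (A B : Subset p) →
    Nonempty A → Nonempty B →
    ℕ→ℚ ∣ A ∣ ≤ c * ℕ→ℚ ∣ B ∣ →
    ℕ→ℚ ∣ B ∣ ≤ c * ℕ→ℚ ∣ A ∣ →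
    ℕ→ℚ (∣ A ∣ ^ 2) ≤ (c ^ℚ 2) * ℕ→ℚ p →
    ℕ→ℚ (∣ A ∣ ^ 15) ≤ (C ^ℚ 14) * ℕ→ℚ ((∣ sumset A B ∣ ⊔ ∣ prodset A B ∣) ^ 14))
theorem1p5 c 1≤c = ℕ→ℚ (ℕ.suc D) , ℕ→ℚ-positive D ,
    λ p isPrime A B A≢∅ B≢∅ a≤cb b≤ca a²≤c²p →
      power-bound D 13 (PrimeFields.sum-product-𝔽ₚ (natural-bound c) p isPrime A B A≢∅ B≢∅
        (scale-bound c a≤cb) (scale-bound c b≤ca) (scale-bound² c 1≤c {∣ A ∣} {p} a²≤c²p))
  where
  D : ℕ
  D = Constants.growth (natural-bound c)
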